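{- Let $r\ge0$, $a=r+4$, $V=\mathbb F_3^a=P\oplus R$ with $P=\mathbb F_3^4$ and $\dim R=r$, and equip $V$ with an alternating form $\omega$ whose radical is $R$ and whose restriction to $P$ is $\omega(x,y)=x_0y_1-x_1y_0+x_2y_3-x_3y_2$. Write $\bar v\in P$ for the projection of $v\in V$ along $R$. If $S=(v_i)_{i=1}^{n}$ is an indexed list of vectors of $V$ that is No-full, has length $n=2a+3$, and satisfies $\bar v_i\neq0$ for every index $i$, then $\Theta(S)=0$ in $\mathbb F_3$.
   Context: For an indexed list $S=(v_i)_{i=1}^n$ in $V$, a block is a subset $B\subseteq[n]$ of indices; it is vector-zero if $\sum_{i\in B}v_i=0$. The nonorthogonality graph of $B$ has vertex set $B$, with $i,j$ adjacent when $\omega(v_i,v_j)\neq0$. A triple $\{i,j,k\}$ of indices is balanced if $\omega(v_i,v_j)=\omega(v_j,v_k)=\omega(v_k,v_i)\neq0$ (independent of the ordering chosen). The list $S$ is No-full if for every vector-zero block $B$ the nonorthogonality graph of $B$ either has no edges (the block is commuting) or consists of exactly one balanced triangle together with isolated vertices. For an index set $Y\subseteq[n]$ put \[ N(Y)=\sum_{B\subseteq[n],\ \sum_{i\in B}v_i=0,\ Y\subseteq B}(-1)^{|B|}\in\mathbb F_3 \] (the empty block is included when $Y=\varnothing$). For a balanced triple $K$ put $\mu_K=-N(K)$, and $\Theta(S)=\sum_{K\text{ balanced}}\mu_K\in\mathbb F_3$. -}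

module Defs where

open import Data.Bool using (if_then_else_)
open import Data.Bool.Properties using () renaming (_≟_ to _≟ᵇ_)
open import Data.Fin using (Fin; toℕ; _≟_)
open import Data.Fin.Patterns using (0F; 1F)
open import Data.Fin.Properties using (any?)
open import Data.Fin.Subset
  using (Subset; inside; outside; _∈_; _⊆_; _∪_; ⁅_⁆; ∣_∣)
open import Data.Fin.Subset.Properties using (_⊆?_)
open import Data.List using (List; []; _∷_; _++_; map; filter; foldr)
open import Data.Nat as ℕ using (ℕ; zero; suc)
open import Data.Nat.DivMod using (_mod_)
open import Data.Product using (∃-syntax; _×_)
open import Data.Sum using (_⊎_)
open import Data.Vec as Vec using (Vec; []; _∷_)
open import Data.Vec.Functional as Vector using (Vector)
open import Data.Vec.Properties using (≡-dec)
open import Function.Bundles using (_⇔_)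
open import Relation.Binary.PropositionalEquality using (_≡_; _≢_)
open import Relation.Nullary using (Dec; ¬_; ¬?; _×-dec_)

F₃ : Set
F₃ = Fin 3

infixl 6 _+_ _-_
infixl 7 _*_
infix  8 -_
infixr 8 _^_

0# 1# : F₃
0# = 0F
1# = 1F

_+_ _*_ : F₃ → F₃ → F₃
x + y = (toℕ x ℕ.+ toℕ y) mod 3
x * y = (toℕ x ℕ.* toℕ y) mod 3

-_ : F₃ → F₃
- x = (3 ℕ.∸ toℕ x) mod 3

_-_ : F₃ → F₃ → F₃
x - y = x + (- y)

_^_ : F₃ → ℕ → F₃
x ^ zero  = 1#
x ^ suc k = x * x ^ k

∑ : {A : Set} → List A → (A → F₃) → F₃
∑ xs f = foldr _+_ 0# (map f xs)

F₃^ : ℕ → Set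
F₃^ a = Vec F₃ a

0ᵛ : ∀ {a} → F₃^ a
0ᵛ = Vec.replicate _ 0#

infixl 6 _+ᵛ_
infixr 7 _·_

_+ᵛ_ : ∀ {a} → F₃^ a → F₃^ a → F₃^ a
_+ᵛ_ = Vec.zipWith _+_

_·_ : ∀ {a} → F₃ → F₃^ a → F₃^ a
c · v = Vec.map (c *_) v

record IsAlternatingForm {a} (ω : F₃^ a → F₃^ a → F₃) : Set where
  field
    +-linearˡ   : ∀ x y z → ω (x +ᵛ y) z ≡ ω x z + ω y z
    ·-linearˡ   : ∀ c x y → ω (c · x) y ≡ c * ω x y
    +-linearʳ   : ∀ x y z → ω x (y +ᵛ z) ≡ ω x y + ω x z
    ·-linearʳ   : ∀ c x y → ω x (c · y) ≡ c * ω x y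
    alternating : ∀ x → ω x x ≡ 0#

InRadical : ∀ {a} → (F₃^ a → F₃^ a → F₃) → F₃^ a → Set
InRadical ω x = ∀ y → ω x y ≡ 0#

-- F₃^ (4 ℕ.+ r) is P ⊕ R, where P is the span of the first four coordinate
-- vectors (identified with F₃^ 4) and R that of the remaining r.

ιP : ∀ {r} → F₃^ 4 → F₃^ (4 ℕ.+ r)
ιP p = p Vec.++ 0ᵛ

InR : ∀ {r} → F₃^ (4 ℕ.+ r) → Set
InR {r} x = ∃[ z ] x ≡ 0ᵛ {4} Vec.++ z

projP : ∀ {r} → F₃^ (4 ℕ.+ r) → F₃^ 4
projP = Vec.take 4

ωP : F₃^ 4 → F₃^ 4 → F₃
ωP (x₀ ∷ x₁ ∷ x₂ ∷ x₃ ∷ []) (y₀ ∷ y₁ ∷ y₂ ∷ y₃ ∷ []) =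
  x₀ * y₁ - x₁ * y₀ + x₂ * y₃ - x₃ * y₂

subsets : ∀ n → List (Subset n)
subsets zero    = [] ∷ []
subsets (suc n) = map (outside ∷_) (subsets n) ++ map (inside ∷_) (subsets n)

module _ {a n : ℕ} (ω : F₃^ a → F₃^ a → F₃) (S : Vector (F₃^ a) n) where

  blockSum : Subset n → F₃^ a
  blockSum B =
    Vector.foldr _+ᵛ_ 0ᵛ λ i → if Vec.lookup B i then S i else 0ᵛ

  VectorZero : Subset n → Set
  VectorZero B = blockSum B ≡ 0ᵛ

  vectorZero? : ∀ B → Dec (VectorZero B)
  vectorZero? B = ≡-dec _≟_ (blockSum B) 0ᵛ

  Edge : Subset n → Fin n → Fin n → Set
  Edge B i j = i ∈ B × j ∈ B × ω (S i) (S j) ≢ 0#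

  -- For alternating ω the indices i, j, k are automatically distinct, so K
  -- has three elements.  Only some ordering of K is asked for: reversing the
  -- ordering negates all three values.
  Balanced : Subset n → Set
  Balanced K = ∃[ i ] ∃[ j ] ∃[ k ]
    K ≡ ⁅ i ⁆ ∪ ⁅ j ⁆ ∪ ⁅ k ⁆ ×
    ω (S i) (S j) ≡ ω (S j) (S k) ×
    ω (S j) (S k) ≡ ω (S k) (S i) ×
    ω (S k) (S i) ≢ 0#

  balanced? : ∀ K → Dec (Balanced K)
  balanced? K = any? λ i → any? λ j → any? λ k →
    ≡-dec _≟ᵇ_ K (⁅ i ⁆ ∪ ⁅ j ⁆ ∪ ⁅ k ⁆) ×-dec
    (ω (S i) (S j) ≟ ω (S j) (S k)) ×-dec
    (ω (S j) (S k) ≟ ω (S k) (S i)) ×-dec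
    ¬? (ω (S k) (S i) ≟ 0#)

  Commuting : Subset n → Set
  Commuting B = ∀ i j → ¬ Edge B i j

  -- The edges of the graph on B are exactly those of the complete graph on a
  -- balanced triple K, so all other vertices are isolated.
  OneBalancedTriangle : Subset n → Set
  OneBalancedTriangle B = ∃[ K ]
    Balanced K × (∀ i j → Edge B i j ⇔ (i ∈ K × j ∈ K × i ≢ j))

  NoFull : Set
  NoFull = ∀ B → VectorZero B → Commuting B ⊎ OneBalancedTriangle B

  N : Subset n → F₃
  N Y = ∑ (filter (λ B → vectorZero? B ×-dec Y ⊆? B) (subsets n))
          λ B → (- 1#) ^ ∣ B ∣

  μ : Subset n → F₃
  μ K = - N K

  Θ : F₃
  Θ = ∑ (filter balanced? (subsets n)) μ

{-# OPTIONS --safe #-}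

-- The indicator of a vector-zero block is a polynomial of degree 2a, so N
-- vanishes on all pairs of indices when n = 2a + 3.  A vector-zero block
-- through an edge ij contains exactly one balanced triple through ij, hence
-- the N K with K balanced and i, j ∈ K sum to zero.  It remains to mark one
-- edge of every live triangle (a balanced K with N K ≠ 0) in such a way that
-- the live triangles through an edge agree on whether it is marked.
--
-- For this let h_K be the vector sum of K.  In rank four the isolated vectors
-- of a block through K span, modulo R, a line containing h_K (this uses that
-- no projection vanishes); every edge of a live triangle lies in a second live
-- triangle; and any two blocks with a triangle intersect.  These three facts
-- force ω(h_K, h_K′) = 0 for all live K and K′.  Thus, for an index e such that
-- ω(e, –) vanishes on all h_K′ orthogonal to an edge of K, the values of
-- ω(e, –) on the vertices of K sum to zero; if they are not equal they are
-- 0, 1, 2.  The first e that separates the ends of an edge is the same for the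
-- three edges of K, and the edge on which ω(e, –) takes the values 0 and 1 is
-- marked.

module Submission where

open import Defs
open import Data.Bool using (if_then_else_)
open import Data.Bool.Properties using () renaming (_≟_ to _≟ᵇ_)
open import Data.Empty using (⊥; ⊥-elim)
open import Data.Fin as Fin using (Fin; zero; suc; _≟_)
open import Data.Fin.Patterns using (0F; 1F; 2F; 3F)
open import Data.Fin.Properties as Finₚ using (all?; any?; pigeonhole)
open import Data.Fin.Subset
  using (Subset; inside; outside; _∈_; _⊆_; _∪_; ⁅_⁆; ∣_∣)
open import Data.Fin.Subset.Properties
  using (_∈?_; _⊆?_; x∈⁅x⁆; x∈⁅y⁆⇒x≡y; x∈p∪q⁻; x∈p∪q⁺; ∣⁅x⁆∣≡1; ⊆-antisym; anySubset?)
open import Data.List using (List; []; _∷_; _++_; map; filter; allFin; tabulate)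
import Data.List.Properties as Listₚ
open import Data.Maybe as Maybe using (Maybe; just; nothing)
open import Data.Nat as ℕ using (ℕ; zero; suc; pred)
import Data.Nat.Properties as ℕₚ
open import Data.Product using (∃-syntax; _×_; _,_; proj₁; proj₂)
open import Data.Sum using (_⊎_; inj₁; inj₂)
open import Data.Vec as Vec using ([]; _∷_; here; there)
open import Data.Vec.Functional using (Vector)
open import Data.Vec.Properties as Vecₚ using (≡-dec)
open import Function using (_∘_)
open import Function.Bundles using (_⇔_; Equivalence)
open import Relation.Binary.PropositionalEquality
open import Relation.Nullary
  using (Dec; yes; no; does; ¬_; ¬?; _×-dec_; _⊎-dec_; _→-dec_; contradiction)
open import Relation.Nullary.Decidable using (decidable-stable; from-yes; map′)
open import Relation.Unary using (Decidable)

-- Summing the edge relations over all edges proves nothing: a triple has three edges and 3 = 0 in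
-- `F₃`. One edge per live triangle must be singled out, and as a relation involves every live
-- triangle through its edge, the choice has to be readable from the edge alone. This obstacle is
-- the reason for the geometric part. What ω(h_K, h_K′) = 0 provides is the passage from an edge to
-- its triangle: if h_K′ is orthogonal to two vertices of K, it is orthogonal to the third. So the
-- condition on e, stated for an edge, depends on the triangle only. The ends of the edge satisfy
-- it, hence a separating e exists. Since h_K is orthogonal to the vertices of K, e is orthogonal to
-- h_K, which is the zero sum; three elements of `F₃` with zero sum are all equal or all different.
-- The length of the list enters once: a pair leaves 2a + 1 free indices, each of them contributes
-- one difference, and 2a + 1 differences kill a polynomial of degree 2a.

private variable
  X Y : Set
  n   : ℕ

-- Arithmetic in F₃ and finite sums

+-assoc : ∀ x y z → (x + y) + z ≡ x + (y + z)
+-assoc = from-yes (all? λ x → all? λ y → all? λ z → (x + y) + z ≟ x + (y + z))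

+-comm : ∀ x y → x + y ≡ y + x
+-comm = from-yes (all? λ x → all? λ y → x + y ≟ y + x)

+-identityˡ : ∀ x → 0# + x ≡ x
+-identityˡ = from-yes (all? λ x → 0# + x ≟ x)

+-identityʳ : ∀ x → x + 0# ≡ x
+-identityʳ = from-yes (all? λ x → x + 0# ≟ x)

-‿inverseʳ : ∀ x → x - x ≡ 0#
-‿inverseʳ = from-yes (all? λ x → x - x ≟ 0#)

*-assoc : ∀ x y z → (x * y) * z ≡ x * (y * z)
*-assoc = from-yes (all? λ x → all? λ y → all? λ z → (x * y) * z ≟ x * (y * z))

*-comm : ∀ x y → x * y ≡ y * x
*-comm = from-yes (all? λ x → all? λ y → x * y ≟ y * x)

*-identityˡ : ∀ x → 1# * x ≡ x
*-identityˡ = from-yes (all? λ x → 1# * x ≟ x)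

*-zeroˡ : ∀ x → 0# * x ≡ 0#
*-zeroˡ = from-yes (all? λ x → 0# * x ≟ 0#)

*-zeroʳ : ∀ x → x * 0# ≡ 0#
*-zeroʳ = from-yes (all? λ x → x * 0# ≟ 0#)

*-distribˡ-+ : ∀ x y z → x * (y + z) ≡ x * y + x * z
*-distribˡ-+ = from-yes (all? λ x → all? λ y → all? λ z → x * (y + z) ≟ x * y + x * z)

+-interchange : ∀ w x y z → (w + x) + (y + z) ≡ (w + y) + (x + z)
+-interchange = from-yes (all? λ w → all? λ x → all? λ y → all? λ z →
  (w + x) + (y + z) ≟ (w + y) + (x + z))

∑-cong : ∀ (xs : List X) {f g : X → F₃} → (∀ x → f x ≡ g x) → ∑ xs f ≡ ∑ xs g
∑-cong []       f≗g = refl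
∑-cong (x ∷ xs) f≗g = cong₂ _+_ (f≗g x) (∑-cong xs f≗g)

∑-zero : ∀ (xs : List X) {f : X → F₃} → (∀ x → f x ≡ 0#) → ∑ xs f ≡ 0#
∑-zero []       f≗0 = refl
∑-zero (x ∷ xs) f≗0 = cong₂ _+_ (f≗0 x) (∑-zero xs f≗0)

∑-+ : ∀ (xs : List X) (f g : X → F₃) → ∑ xs (λ x → f x + g x) ≡ ∑ xs f + ∑ xs g
∑-+ []       f g = refl
∑-+ (x ∷ xs) f g rewrite ∑-+ xs f g = +-interchange (f x) (g x) (∑ xs f) (∑ xs g)

∑-*ˡ : ∀ (xs : List X) c (f : X → F₃) → ∑ xs (λ x → c * f x) ≡ c * ∑ xs f
∑-*ˡ []       c f = sym (*-zeroʳ c)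
∑-*ˡ (x ∷ xs) c f rewrite ∑-*ˡ xs c f = sym (*-distribˡ-+ c (f x) (∑ xs f))

∑-++ : ∀ (xs ys : List X) (f : X → F₃) → ∑ (xs ++ ys) f ≡ ∑ xs f + ∑ ys f
∑-++ []       ys f = sym (+-identityˡ (∑ ys f))
∑-++ (x ∷ xs) ys f rewrite ∑-++ xs ys f = sym (+-assoc (f x) (∑ xs f) (∑ ys f))

∑-map : ∀ (h : X → Y) (xs : List X) (f : Y → F₃) → ∑ (map h xs) f ≡ ∑ xs (f ∘ h)
∑-map h []       f = refl
∑-map h (x ∷ xs) f = cong (f (h x) +_) (∑-map h xs f)

∑-swap : ∀ (xs : List X) (ys : List Y) (f : X → Y → F₃) →
  ∑ xs (λ x → ∑ ys (f x)) ≡ ∑ ys (λ y → ∑ xs (λ x → f x y))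
∑-swap []       ys f = sym (∑-zero ys λ _ → refl)
∑-swap (x ∷ xs) ys f rewrite ∑-swap xs ys f =
  sym (∑-+ ys (f x) (λ y → ∑ xs (λ x → f x y)))

⟦_⟧ : ∀ {p} {P : Set p} → Dec P → F₃
⟦ P? ⟧ = if does P? then 1# else 0#

⟦⟧-yes : ∀ {p} {P : Set p} (P? : Dec P) → P → ⟦ P? ⟧ ≡ 1#
⟦⟧-yes (yes _) _ = refl
⟦⟧-yes (no ¬p) p = contradiction p ¬p

⟦⟧-no : ∀ {p} {P : Set p} (P? : Dec P) → ¬ P → ⟦ P? ⟧ ≡ 0#
⟦⟧-no (yes p) ¬p = contradiction p ¬p
⟦⟧-no (no _)  _  = refl

⟦⟧-≢0 : ∀ {p} {P : Set p} (P? : Dec P) {x} → ⟦ P? ⟧ * x ≢ 0# → P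
⟦⟧-≢0 (yes p) _  = p
⟦⟧-≢0 (no _) {x} ne = contradiction (*-zeroˡ x) ne

⟦⟧-× : ∀ {p q} {P : Set p} {Q : Set q} (P? : Dec P) (Q? : Dec Q) →
  ⟦ P? ×-dec Q? ⟧ ≡ ⟦ P? ⟧ * ⟦ Q? ⟧
⟦⟧-× (yes _) Q? = sym (*-identityˡ ⟦ Q? ⟧)
⟦⟧-× (no _)  Q? = sym (*-zeroˡ ⟦ Q? ⟧)

⟦⟧-⇔ : ∀ {p q} {P : Set p} {Q : Set q} (P? : Dec P) (Q? : Dec Q) →
  (P → Q) → (Q → P) → ⟦ P? ⟧ ≡ ⟦ Q? ⟧
⟦⟧-⇔ (yes p) Q? to from = sym (⟦⟧-yes Q? (to p))
⟦⟧-⇔ (no ¬p) Q? to from = sym (⟦⟧-no Q? (¬p ∘ from))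

∑-filter : ∀ {P : X → Set} (P? : Decidable P) (xs : List X) (f : X → F₃) →
  ∑ (filter P? xs) f ≡ ∑ xs (λ x → ⟦ P? x ⟧ * f x)
∑-filter P? []       f = refl
∑-filter P? (x ∷ xs) f with P? x
... | yes _ = cong₂ _+_ (sym (*-identityˡ (f x))) (∑-filter P? xs f)
... | no  _ = trans (∑-filter P? xs f)
  (sym (trans (cong (_+ ∑ xs (λ x → ⟦ P? x ⟧ * f x)) (*-zeroˡ (f x))) (+-identityˡ _)))

+ᵛ-comm : ∀ {a} (u v : F₃^ a) → u +ᵛ v ≡ v +ᵛ u
+ᵛ-comm = Vecₚ.zipWith-comm +-comm

+ᵛ-assoc : ∀ {a} (u v w : F₃^ a) → (u +ᵛ v) +ᵛ w ≡ u +ᵛ (v +ᵛ w)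
+ᵛ-assoc = Vecₚ.zipWith-assoc +-assoc

+ᵛ-identityˡ : ∀ {a} (v : F₃^ a) → 0ᵛ +ᵛ v ≡ v
+ᵛ-identityˡ = Vecₚ.zipWith-identityˡ +-identityˡ

-- The polynomial method, with polynomials replaced by the functions that are
-- killed by every d-fold iterated difference.

module Degree {A : Set} (_∙_ : A → A → A)
  (swap : ∀ x y z → (x ∙ y) ∙ z ≡ (x ∙ z) ∙ y) where

  Δ : (A → F₃) → A → A → F₃
  Δ F v x = F x - F (x ∙ v)

  Deg< : ℕ → (A → F₃) → Set
  Deg< zero    F = ∀ x → F x ≡ 0#
  Deg< (suc d) F = ∀ v → Deg< d (Δ F v)

  Deg<-cong : ∀ d F G → (∀ x → F x ≡ G x) → Deg< d F → Deg< d G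
  Deg<-cong zero    F G F≗G F<0 x = trans (sym (F≗G x)) (F<0 x)
  Deg<-cong (suc d) F G F≗G F<d v = Deg<-cong d (Δ F v) (Δ G v)
    (λ x → cong₂ _-_ (F≗G x) (F≗G (x ∙ v))) (F<d v)

  Deg<-zero : ∀ d F → (∀ x → F x ≡ 0#) → Deg< d F
  Deg<-zero zero    F F≗0 = F≗0
  Deg<-zero (suc d) F F≗0 v = Deg<-zero d (Δ F v)
    λ x → cong₂ _-_ (F≗0 x) (F≗0 (x ∙ v))

  Deg<-+ : ∀ d F G → Deg< d F → Deg< d G → Deg< d (λ x → F x + G x)
  Deg<-+ zero    F G F<0 G<0 x = cong₂ _+_ (F<0 x) (G<0 x)
  Deg<-+ (suc d) F G F<d G<d v = Deg<-cong d
    (λ x → Δ F v x + Δ G v x) (Δ (λ x → F x + G x) v)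
    (λ x → rearrange (F x) (F (x ∙ v)) (G x) (G (x ∙ v)))
    (Deg<-+ d (Δ F v) (Δ G v) (F<d v) (G<d v))
    where
    rearrange : ∀ w x y z → (w - x) + (y - z) ≡ (w + y) - (x + z)
    rearrange = from-yes (all? λ w → all? λ x → all? λ y → all? λ z →
      (w - x) + (y - z) ≟ (w + y) - (x + z))

  Deg<-shift : ∀ d F w → Deg< d F → Deg< d (λ x → F (x ∙ w))
  Deg<-shift zero    F w F<0 x = F<0 (x ∙ w)
  Deg<-shift (suc d) F w F<d v = Deg<-cong d
    (λ x → Δ F v (x ∙ w)) (Δ (λ x → F (x ∙ w)) v)
    (λ x → cong (λ y → F (x ∙ w) - F y) (swap x w v))
    (Deg<-shift d (Δ F v) w (F<d v))

+-swap : ∀ x y z → (x + y) + z ≡ (x + z) + y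
+-swap = from-yes (all? λ x → all? λ y → all? λ z → (x + y) + z ≟ (x + z) + y)

module Scalar = Degree _+_ +-swap

+ᵛ-swap : ∀ {a} (x y z : F₃^ a) → (x +ᵛ y) +ᵛ z ≡ (x +ᵛ z) +ᵛ y
+ᵛ-swap x y z =
  trans (+ᵛ-assoc x y z) (trans (cong (x +ᵛ_) (+ᵛ-comm y z)) (sym (+ᵛ-assoc x z y)))

module Vectors {a : ℕ} = Degree (_+ᵛ_ {a}) +ᵛ-swap
open Vectors

_⊗_ : ∀ {a} → (F₃ → F₃) → (F₃^ a → F₃) → F₃^ (suc a) → F₃
(f ⊗ G) (x ∷ xs) = f x * G xs

-- Factors of degree at most p - 1 and q - 1 have a product of degree at most p + q - 2, whence the
-- `pred`. The product rule splits a difference in direction (u, v) into one of the first factor and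
-- one of the second.
Deg<-⊗ : ∀ p q {a} (f : F₃ → F₃) (G : F₃^ a → F₃) →
  Scalar.Deg< p f → Deg< q G → Deg< (pred (p ℕ.+ q)) (f ⊗ G)
Deg<-⊗ zero q f G f<p G<q = Deg<-zero (pred q) (f ⊗ G) λ where
  (x ∷ xs) → trans (cong (_* G xs) (f<p x)) (*-zeroˡ (G xs))
Deg<-⊗ (suc p) zero f G f<p G<q = Deg<-zero (p ℕ.+ 0) (f ⊗ G) λ where
  (x ∷ xs) → trans (cong (f x *_) (G<q xs)) (*-zeroʳ (f x))
Deg<-⊗ (suc p) (suc q) f G f<p G<q =
  subst (λ d → Deg< d (f ⊗ G)) (sym (ℕₚ.+-suc p q)) step
  where
  product-rule : ∀ x x′ y y′ → (x - x′) * y + x′ * (y - y′) ≡ x * y - x′ * y′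
  product-rule = from-yes (all? λ x → all? λ x′ → all? λ y → all? λ y′ →
    (x - x′) * y + x′ * (y - y′) ≟ x * y - x′ * y′)
  step : Deg< (suc (p ℕ.+ q)) (f ⊗ G)
  step (u ∷ v) = Deg<-cong (p ℕ.+ q)
    (λ x → (f′ ⊗ G) x + (f⁺ ⊗ G′) x) (Δ (f ⊗ G) (u ∷ v))
    (λ where (x ∷ xs) → product-rule (f x) (f (x + u)) (G xs) (G (xs +ᵛ v)))
    (Deg<-+ (p ℕ.+ q) (f′ ⊗ G) (f⁺ ⊗ G′)
      (subst (λ d → Deg< d (f′ ⊗ G)) (cong pred (ℕₚ.+-suc p q))
        (Deg<-⊗ p (suc q) f′ G (f<p u) G<q))
      (Deg<-⊗ (suc p) q f⁺ G′ (Scalar.Deg<-shift (suc p) f u f<p) (G<q v)))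
    where
    f′ = Scalar.Δ f u
    f⁺ = λ x → f (x + u)
    G′ = Δ G v

δ₁ : F₃ → F₃
δ₁ x = ⟦ x ≟ 0# ⟧

δ : ∀ {a} → F₃^ a → F₃
δ x = ⟦ ≡-dec _≟_ x 0ᵛ ⟧

-- The indicator of 0 on `F₃` is 1 - x², of degree 2. The table checks its threefold difference,
-- written out.
δ₁-deg : Scalar.Deg< 3 δ₁
δ₁-deg = from-yes (all? λ u → all? λ v → all? λ w → all? λ x →
  ((δ₁ x - δ₁ (x + u)) - (δ₁ (x + v) - δ₁ (x + v + u))) -
  ((δ₁ (x + w) - δ₁ (x + w + u)) - (δ₁ (x + w + v) - δ₁ (x + w + v + u))) ≟ 0#)

δ-deg : ∀ a → Deg< (suc (2 ℕ.* a)) (δ {a})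
δ-deg zero    = λ where [] [] → refl
δ-deg (suc a) = subst (λ d → Deg< d (δ {suc a})) (cong suc (sym (ℕₚ.*-suc 2 a)))
  (Deg<-cong (3 ℕ.+ 2 ℕ.* a) (δ₁ ⊗ δ) δ (λ where (x ∷ xs) → δ-∷ x xs)
    (Deg<-⊗ 3 (suc (2 ℕ.* a)) δ₁ δ δ₁-deg (δ-deg a)))
  where
  δ-∷ : ∀ x (xs : F₃^ a) → δ₁ x * δ xs ≡ δ (x ∷ xs)
  δ-∷ x xs with x ≟ 0#
  ... | no  _ = *-zeroˡ (δ xs)
  ... | yes _ with ≡-dec _≟_ xs 0ᵛ
  ...   | yes _ = refl
  ...   | no  _ = refl

-- Alternating sums over blocks as iterated differences

free : ∀ {n} → Subset n → ℕ
free []            = 0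
free (outside ∷ Y) = suc (free Y)
free (inside  ∷ Y) = free Y

module _ {a : ℕ} (ω : F₃^ a → F₃^ a → F₃) where

  private
    term : ∀ {n} (S : Vector (F₃^ a) n) (Y : Subset n) (F : F₃^ a → F₃) → Subset n → F₃
    term S Y F B = ⟦ Y ⊆? B ⟧ * ((- 1#) ^ ∣ B ∣ * F (blockSum ω S B))

  -- Up to sign the sum is the iterated difference of `F` in the directions `S i` with i outside
  -- `Y`, taken at the vector sum of `Y`. An index outside `Y` pairs each block with its extension,
  -- and the sign turns the pair into a difference; an index of `Y` only shifts the argument and
  -- contributes a factor -1.
  signedSum-vanishes : ∀ {n} (S : Vector (F₃^ a) n) (Y : Subset n) d (F : F₃^ a → F₃) →
    d ℕ.≤ free Y → Deg< d F →
    ∑ (subsets n) (λ B → ⟦ Y ⊆? B ⟧ * ((- 1#) ^ ∣ B ∣ * F (blockSum ω S B))) ≡ 0#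
  signedSum-vanishes {n} S Y zero F d≤ F<0 = ∑-zero (subsets n) λ B →
    trans (cong (λ z → ⟦ Y ⊆? B ⟧ * ((- 1#) ^ ∣ B ∣ * z)) (F<0 (blockSum ω S B)))
      (trans (cong (⟦ Y ⊆? B ⟧ *_) (*-zeroʳ ((- 1#) ^ ∣ B ∣))) (*-zeroʳ ⟦ Y ⊆? B ⟧))
  signedSum-vanishes {suc n} S (outside ∷ Y) (suc d) F (ℕ.s≤s d≤) F<d = begin
    ∑ (subsets (suc n)) (term S (outside ∷ Y) F)
      ≡⟨ ∑-++ (map (outside ∷_) (subsets n)) _ _ ⟩
    _ ≡⟨ cong₂ _+_ (∑-map (outside ∷_) (subsets n) _) (∑-map (inside ∷_) (subsets n) _) ⟩
    _ ≡⟨ ∑-+ (subsets n) _ _ ⟨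
    _ ≡⟨ ∑-cong (subsets n) paired ⟩
    _ ≡⟨ signedSum-vanishes (S ∘ suc) Y d (Δ F (S zero)) d≤ (F<d (S zero)) ⟩
    0# ∎
    where
    open ≡-Reasoning
    factor : ∀ b s x y → b * (s * x) + b * ((- 1# * s) * y) ≡ b * (s * (x - y))
    factor = from-yes (all? λ b → all? λ s → all? λ x → all? λ y →
      b * (s * x) + b * ((- 1# * s) * y) ≟ b * (s * (x - y)))
    paired : ∀ B →
      term S (outside ∷ Y) F (outside ∷ B) + term S (outside ∷ Y) F (inside ∷ B) ≡
      term (S ∘ suc) Y (Δ F (S zero)) B
    paired B = trans
      (cong₂ (λ u v → b * (s * F u) + b * ((- 1# * s) * F v))
        (+ᵛ-identityˡ x) (+ᵛ-comm (S zero) x))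
      (factor b s (F x) (F (x +ᵛ S zero)))
      where
      b = ⟦ Y ⊆? B ⟧
      s = (- 1#) ^ ∣ B ∣
      x = blockSum ω (S ∘ suc) B
  signedSum-vanishes {suc n} S (inside ∷ Y) (suc d) F d≤ F<d = begin
    ∑ (subsets (suc n)) (term S (inside ∷ Y) F)
      ≡⟨ ∑-++ (map (outside ∷_) (subsets n)) _ _ ⟩
    _ ≡⟨ cong₂ _+_ (∑-map (outside ∷_) (subsets n) _) (∑-map (inside ∷_) (subsets n) _) ⟩
    _ ≡⟨ cong₂ _+_ (∑-zero (subsets n) λ B → *-zeroˡ ((- 1#) ^ ∣ B ∣ * F (blockSum ω S (outside ∷ B)))) (∑-cong (subsets n) shifted) ⟩
    _ ≡⟨ +-identityˡ _ ⟩
    _ ≡⟨ ∑-*ˡ (subsets n) (- 1#) _ ⟩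
    _ ≡⟨ cong (- 1# *_) (signedSum-vanishes (S ∘ suc) Y (suc d) (λ x → F (x +ᵛ S zero)) d≤
           (Deg<-shift (suc d) F (S zero) F<d)) ⟩
    0# ∎
    where
    open ≡-Reasoning
    factor : ∀ b s x → b * ((- 1# * s) * x) ≡ - 1# * (b * (s * x))
    factor = from-yes (all? λ b → all? λ s → all? λ x →
      b * ((- 1# * s) * x) ≟ - 1# * (b * (s * x)))
    shifted : ∀ B → term S (inside ∷ Y) F (inside ∷ B) ≡
      - 1# * term (S ∘ suc) Y (λ x → F (x +ᵛ S zero)) B
    shifted B = trans
      (cong (λ v → b * ((- 1# * s) * F v)) (+ᵛ-comm (S zero) x))
      (factor b s (F (x +ᵛ S zero)))
      where
      b = ⟦ Y ⊆? B ⟧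
      s = (- 1#) ^ ∣ B ∣
      x = blockSum ω (S ∘ suc) B

  N-expand : ∀ {n} (S : Vector (F₃^ a) n) Y → N ω S Y ≡
    ∑ (subsets n) (λ B → ⟦ Y ⊆? B ⟧ * ((- 1#) ^ ∣ B ∣ * ⟦ vectorZero? ω S B ⟧))
  N-expand {n} S Y = trans (∑-filter _ (subsets n) _) (∑-cong (subsets n) λ B →
    trans (cong (_* (- 1#) ^ ∣ B ∣) (⟦⟧-× (vectorZero? ω S B) (Y ⊆? B)))
      (reorder ⟦ vectorZero? ω S B ⟧ ⟦ Y ⊆? B ⟧ ((- 1#) ^ ∣ B ∣)))
    where
    reorder : ∀ z b s → (z * b) * s ≡ b * (s * z)
    reorder = from-yes (all? λ z → all? λ b → all? λ s → (z * b) * s ≟ b * (s * z))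

  N-vanishes : ∀ {n} (S : Vector (F₃^ a) n) Y → suc (2 ℕ.* a) ℕ.≤ free Y → N ω S Y ≡ 0#
  N-vanishes S Y 2a<free = trans (N-expand S Y)
    (signedSum-vanishes S Y (suc (2 ℕ.* a)) δ 2a<free (δ-deg a))

-- The symplectic space P

det : F₃ → F₃ → F₃ → F₃ → F₃
det x₀ x₁ y₀ y₁ = x₀ * y₁ - x₁ * y₀

-- The Grassmann-Plücker relation for four vectors of a plane.
det-plücker : ∀ a₀ a₁ b₀ b₁ e₀ e₁ h₀ h₁ →
  det a₀ a₁ b₀ b₁ * det e₀ e₁ h₀ h₁ ≡
  det a₀ a₁ e₀ e₁ * det b₀ b₁ h₀ h₁ - det a₀ a₁ h₀ h₁ * det b₀ b₁ e₀ e₁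
det-plücker = from-yes (all? λ a₀ → all? λ a₁ → all? λ b₀ → all? λ b₁ →
  all? λ e₀ → all? λ e₁ → all? λ h₀ → all? λ h₁ →
  det a₀ a₁ b₀ b₁ * det e₀ e₁ h₀ h₁ ≟
  det a₀ a₁ e₀ e₁ * det b₀ b₁ h₀ h₁ - det a₀ a₁ h₀ h₁ * det b₀ b₁ e₀ e₁)

-- Cramer's rule without division: w is zero as soon as a and b are independent.
det-common-orthogonal : ∀ a₀ a₁ b₀ b₁ w₀ w₁ →
  det a₀ a₁ w₀ w₁ ≡ 0# → det b₀ b₁ w₀ w₁ ≡ 0# →
  w₀ * det a₀ a₁ b₀ b₁ ≡ 0# × w₁ * det a₀ a₁ b₀ b₁ ≡ 0#
det-common-orthogonal = from-yes (all? λ a₀ → all? λ a₁ → all? λ b₀ → all? λ b₁ →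
  all? λ w₀ → all? λ w₁ → (det a₀ a₁ w₀ w₁ ≟ 0#) →-dec ((det b₀ b₁ w₀ w₁ ≟ 0#) →-dec
  ((w₀ * det a₀ a₁ b₀ b₁ ≟ 0#) ×-dec (w₁ * det a₀ a₁ b₀ b₁ ≟ 0#))))

det-combination : ∀ a₀ a₁ e₀ e₁ h₀ h₁ p q →
  det a₀ a₁ (p * h₀ - q * e₀) (p * h₁ - q * e₁) ≡ p * det a₀ a₁ h₀ h₁ - q * det a₀ a₁ e₀ e₁
det-combination = from-yes (all? λ a₀ → all? λ a₁ → all? λ e₀ → all? λ e₁ →
  all? λ h₀ → all? λ h₁ → all? λ p → all? λ q →
  det a₀ a₁ (p * h₀ - q * e₀) (p * h₁ - q * e₁) ≟ p * det a₀ a₁ h₀ h₁ - q * det a₀ a₁ e₀ e₁)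

combination-of-parallel : ∀ a₀ a₁ e₀ e₁ h₀ h₁ → det e₀ e₁ h₀ h₁ ≡ 0# →
  e₀ * det a₀ a₁ h₀ h₁ - h₀ * det a₀ a₁ e₀ e₁ ≡ 0# ×
  e₁ * det a₀ a₁ h₀ h₁ - h₁ * det a₀ a₁ e₀ e₁ ≡ 0#
combination-of-parallel = from-yes (all? λ a₀ → all? λ a₁ → all? λ e₀ → all? λ e₁ →
  all? λ h₀ → all? λ h₁ → (det e₀ e₁ h₀ h₁ ≟ 0#) →-dec
  ((e₀ * det a₀ a₁ h₀ h₁ - h₀ * det a₀ a₁ e₀ e₁ ≟ 0#) ×-dec
   (e₁ * det a₀ a₁ h₀ h₁ - h₁ * det a₀ a₁ e₀ e₁ ≟ 0#)))

-- Sixteen coordinates are too many for a table over `F₃`. The argument splits along the two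
-- coordinate planes, on which `ωP` is a sum of two determinants, and shows that all 2 by 2 minors
-- of `e` and `h` vanish. One prime refers to coordinates 0 and 1, two primes to coordinates 2 and
-- 3.
module IsotropicPlane
  (a₀ a₁ a₂ a₃ b₀ b₁ b₂ b₃ e₀ e₁ e₂ e₃ h₀ h₁ h₂ h₃ : F₃) where

  private
    a b e h : F₃^ 4
    a = a₀ ∷ a₁ ∷ a₂ ∷ a₃ ∷ []
    b = b₀ ∷ b₁ ∷ b₂ ∷ b₃ ∷ []
    e = e₀ ∷ e₁ ∷ e₂ ∷ e₃ ∷ []
    h = h₀ ∷ h₁ ∷ h₂ ∷ h₃ ∷ []

    split : ∀ w x y z → w - x + y - z ≡ (w - x) + (y - z)
    split = from-yes (all? λ w → all? λ x → all? λ y → all? λ z →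
      w - x + y - z ≟ (w - x) + (y - z))

    complement : ∀ x y z → x + y - z ≡ 0# → y - z ≡ - x
    complement = from-yes (all? λ x → all? λ y → all? λ z →
      (x + y - z ≟ 0#) →-dec (y - z ≟ - x))

  module Minors (ab≢0 : ωP a b ≢ 0#) (ae≡0 : ωP a e ≡ 0#) (be≡0 : ωP b e ≡ 0#)
    (ah≡0 : ωP a h ≡ 0#) (bh≡0 : ωP b h ≡ 0#) (eh≡0 : ωP e h ≡ 0#) where

    private
      ae″ : det a₂ a₃ e₂ e₃ ≡ - det a₀ a₁ e₀ e₁
      ae″ = complement (det a₀ a₁ e₀ e₁) (a₂ * e₃) (a₃ * e₂) ae≡0
      be″ : det b₂ b₃ e₂ e₃ ≡ - det b₀ b₁ e₀ e₁
      be″ = complement (det b₀ b₁ e₀ e₁) (b₂ * e₃) (b₃ * e₂) be≡0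
      ah″ : det a₂ a₃ h₂ h₃ ≡ - det a₀ a₁ h₀ h₁
      ah″ = complement (det a₀ a₁ h₀ h₁) (a₂ * h₃) (a₃ * h₂) ah≡0
      bh″ : det b₂ b₃ h₂ h₃ ≡ - det b₀ b₁ h₀ h₁
      bh″ = complement (det b₀ b₁ h₀ h₁) (b₂ * h₃) (b₃ * h₂) bh≡0
      eh″ : det e₂ e₃ h₂ h₃ ≡ - det e₀ e₁ h₀ h₁
      eh″ = complement (det e₀ e₁ h₀ h₁) (e₂ * h₃) (e₃ * h₂) eh≡0

      A′ A″ : F₃
      A′ = det a₀ a₁ b₀ b₁
      A″ = det a₂ a₃ b₂ b₃

      A≢0 : A′ + A″ ≢ 0#
      A≢0 = subst (_≢ 0#) (split (a₀ * b₁) (a₁ * b₀) (a₂ * b₃) (a₃ * b₂)) ab≢0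

      minor : ∀ A′ A″ eh ae ah be bh → A′ * eh ≡ ae * bh - ah * be →
        A″ * (- eh) ≡ (- ae) * (- bh) - (- ah) * (- be) → A′ + A″ ≢ 0# → eh ≡ 0#
      minor = from-yes (all? λ A′ → all? λ A″ → all? λ eh → all? λ ae → all? λ ah →
        all? λ be → all? λ bh → (A′ * eh ≟ ae * bh - ah * be) →-dec
        ((A″ * (- eh) ≟ (- ae) * (- bh) - (- ah) * (- be)) →-dec
        (¬? (A′ + A″ ≟ 0#) →-dec (eh ≟ 0#))))

    -- Between the two planes each orthogonality flips the sign of a determinant. The right-hand
    -- sides of the two Plücker relations therefore agree, while the determinant of `e` and `h`
    -- changes sign; so `A′ + A″`, which is `ωP a b`, kills it.
    minor₀₁ : det e₀ e₁ h₀ h₁ ≡ 0#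
    minor₀₁ = minor A′ A″ (det e₀ e₁ h₀ h₁)
      (det a₀ a₁ e₀ e₁) (det a₀ a₁ h₀ h₁) (det b₀ b₁ e₀ e₁) (det b₀ b₁ h₀ h₁)
      (det-plücker a₀ a₁ b₀ b₁ e₀ e₁ h₀ h₁)
      (begin
        A″ * (- det e₀ e₁ h₀ h₁)
          ≡⟨ cong (A″ *_) eh″ ⟨
        A″ * det e₂ e₃ h₂ h₃
          ≡⟨ det-plücker a₂ a₃ b₂ b₃ e₂ e₃ h₂ h₃ ⟩
        det a₂ a₃ e₂ e₃ * det b₂ b₃ h₂ h₃ - det a₂ a₃ h₂ h₃ * det b₂ b₃ e₂ e₃
          ≡⟨ cong₂ _-_ (cong₂ _*_ ae″ bh″) (cong₂ _*_ ah″ be″) ⟩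
        _ ∎)
      A≢0
      where open ≡-Reasoning

    minor₂₃ : det e₂ e₃ h₂ h₃ ≡ 0#
    minor₂₃ = trans eh″ (cong (λ z → - z) minor₀₁)

    private
      negated : ∀ p q x y → p * (- x) - q * (- y) ≡ 0# → p * x - q * y ≡ 0#
      negated = from-yes (all? λ p → all? λ q → all? λ x → all? λ y →
        (p * (- x) - q * (- y) ≟ 0#) →-dec (p * x - q * y ≟ 0#))

      negated⁻¹ : ∀ p q x y → p * x - q * y ≡ 0# → p * (- x) - q * (- y) ≡ 0#
      negated⁻¹ = from-yes (all? λ p → all? λ q → all? λ x → all? λ y →
        (p * x - q * y ≟ 0#) →-dec (p * (- x) - q * (- y) ≟ 0#))

      -- If the minor m did not vanish, then a and b would have orthogonal
      -- projections to both coordinate planes.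
      vanish : ∀ x y z w → (x * w - y * z) * A′ ≡ 0# → (z * y - w * x) * A″ ≡ 0# →
        z * y - w * x ≡ 0#
      vanish x y z w p q = lemma A′ A″ (x * w) (w * x) (y * z) (z * y)
        (*-comm x w) (*-comm y z) A≢0 p q
        where
        lemma : ∀ A′ A″ xw wx yz zy → xw ≡ wx → yz ≡ zy → A′ + A″ ≢ 0# →
          (xw - yz) * A′ ≡ 0# → (zy - wx) * A″ ≡ 0# → zy - wx ≡ 0#
        lemma A′ A″ xw _ yz _ refl refl = table A′ A″ xw yz
          where
          table : ∀ A′ A″ s t → A′ + A″ ≢ 0# → (s - t) * A′ ≡ 0# → (t - s) * A″ ≡ 0# →
            t - s ≡ 0#
          table = from-yes (all? λ A′ → all? λ A″ → all? λ s → all? λ t →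
            ¬? (A′ + A″ ≟ 0#) →-dec (((s - t) * A′ ≟ 0#) →-dec
            (((t - s) * A″ ≟ 0#) →-dec (t - s ≟ 0#))))

      -- The vector w = p h - q e is orthogonal to `a` and `b`. The hypotheses are the vanishing of
      -- the second-plane determinants of w with `a` and `b`; then the first-plane ones vanish too,
      -- and Cramer's rule applies. The multipliers used below are coordinates 2 or 3 of `e` and
      -- `h`, which cancel the second part of w because `e` and `h` are parallel there.
      first : ∀ p q → p * det a₂ a₃ h₂ h₃ - q * det a₂ a₃ e₂ e₃ ≡ 0# →
        p * det b₂ b₃ h₂ h₃ - q * det b₂ b₃ e₂ e₃ ≡ 0# →
        (p * h₀ - q * e₀) * A′ ≡ 0# × (p * h₁ - q * e₁) * A′ ≡ 0#
      first p q α β = det-common-orthogonal a₀ a₁ b₀ b₁ (p * h₀ - q * e₀) (p * h₁ - q * e₁)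
        (trans (det-combination a₀ a₁ e₀ e₁ h₀ h₁ p q) (negated p q (det a₀ a₁ h₀ h₁) (det a₀ a₁ e₀ e₁)
          (subst₂ (λ x y → p * x - q * y ≡ 0#) ah″ ae″ α)))
        (trans (det-combination b₀ b₁ e₀ e₁ h₀ h₁ p q) (negated p q (det b₀ b₁ h₀ h₁) (det b₀ b₁ e₀ e₁)
          (subst₂ (λ x y → p * x - q * y ≡ 0#) bh″ be″ β)))

      second : ∀ p q → p * det a₀ a₁ h₀ h₁ - q * det a₀ a₁ e₀ e₁ ≡ 0# →
        p * det b₀ b₁ h₀ h₁ - q * det b₀ b₁ e₀ e₁ ≡ 0# →
        (p * h₂ - q * e₂) * A″ ≡ 0# × (p * h₃ - q * e₃) * A″ ≡ 0#
      second p q α β = det-common-orthogonal a₂ a₃ b₂ b₃ (p * h₂ - q * e₂) (p * h₃ - q * e₃)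
        (trans (det-combination a₂ a₃ e₂ e₃ h₂ h₃ p q)
          (subst₂ (λ x y → p * x - q * y ≡ 0#) (sym ah″) (sym ae″) (negated⁻¹ p q (det a₀ a₁ h₀ h₁) (det a₀ a₁ e₀ e₁) α)))
        (trans (det-combination b₂ b₃ e₂ e₃ h₂ h₃ p q)
          (subst₂ (λ x y → p * x - q * y ≡ 0#) (sym bh″) (sym be″) (negated⁻¹ p q (det b₀ b₁ h₀ h₁) (det b₀ b₁ e₀ e₁) β)))

      a″ = combination-of-parallel a₂ a₃ e₂ e₃ h₂ h₃ minor₂₃
      b″ = combination-of-parallel b₂ b₃ e₂ e₃ h₂ h₃ minor₂₃
      a′ = combination-of-parallel a₀ a₁ e₀ e₁ h₀ h₁ minor₀₁
      b′ = combination-of-parallel b₀ b₁ e₀ e₁ h₀ h₁ minor₀₁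

    minor₀₂ : e₀ * h₂ - h₀ * e₂ ≡ 0#
    minor₀₂ = vanish e₂ h₂ e₀ h₀
      (proj₁ (first e₂ h₂ (proj₁ a″) (proj₁ b″))) (proj₁ (second e₀ h₀ (proj₁ a′) (proj₁ b′)))
    minor₀₃ : e₀ * h₃ - h₀ * e₃ ≡ 0#
    minor₀₃ = vanish e₃ h₃ e₀ h₀
      (proj₁ (first e₃ h₃ (proj₂ a″) (proj₂ b″))) (proj₂ (second e₀ h₀ (proj₁ a′) (proj₁ b′)))
    minor₁₂ : e₁ * h₂ - h₁ * e₂ ≡ 0#
    minor₁₂ = vanish e₂ h₂ e₁ h₁
      (proj₂ (first e₂ h₂ (proj₁ a″) (proj₁ b″))) (proj₁ (second e₁ h₁ (proj₂ a′) (proj₂ b′)))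
    minor₁₃ : e₁ * h₃ - h₁ * e₃ ≡ 0#
    minor₁₃ = vanish e₃ h₃ e₁ h₁
      (proj₂ (first e₃ h₃ (proj₂ a″) (proj₂ b″))) (proj₂ (second e₁ h₁ (proj₂ a′) (proj₂ b′)))

-- A nonzero element of `F₃` is its own inverse, so `h * e` is the quotient of h by e.
square-cancel : ∀ e h e′ h′ → e ≢ 0# → e * h′ - h * e′ ≡ 0# → h′ ≡ (h * e) * e′
square-cancel = from-yes (all? λ e → all? λ h → all? λ e′ → all? λ h′ →
  ¬? (e ≟ 0#) →-dec ((e * h′ - h * e′ ≟ 0#) →-dec (h′ ≟ (h * e) * e′)))

minor-swap : ∀ e h e′ h′ → e * h′ - h * e′ ≡ 0# → e′ * h - h′ * e ≡ 0#
minor-swap = from-yes (all? λ e → all? λ h → all? λ e′ → all? λ h′ →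
  (e * h′ - h * e′ ≟ 0#) →-dec (e′ * h - h′ * e ≟ 0#))

minor-refl : ∀ e h → e * h - h * e ≡ 0#
minor-refl = from-yes (all? λ e → all? λ h → e * h - h * e ≟ 0#)

minor-det : ∀ e h e′ h′ → det e e′ h h′ ≡ 0# → e * h′ - h * e′ ≡ 0#
minor-det = from-yes (all? λ e → all? λ h → all? λ e′ → all? λ h′ →
  (det e e′ h h′ ≟ 0#) →-dec (e * h′ - h * e′ ≟ 0#))

-- The orthogonal complement of the hyperbolic plane ⟨a, b⟩ is again a
-- hyperbolic plane, so its isotropic subspaces are lines.
isotropic-complement : ∀ a b e h → ωP a b ≢ 0# →
  ωP a e ≡ 0# → ωP b e ≡ 0# → ωP a h ≡ 0# → ωP b h ≡ 0# → ωP e h ≡ 0# →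
  e ≢ 0ᵛ → ∃[ λ′ ] h ≡ λ′ · e
isotropic-complement
  (a₀ ∷ a₁ ∷ a₂ ∷ a₃ ∷ []) (b₀ ∷ b₁ ∷ b₂ ∷ b₃ ∷ [])
  (e₀ ∷ e₁ ∷ e₂ ∷ e₃ ∷ []) (h₀ ∷ h₁ ∷ h₂ ∷ h₃ ∷ []) ab ae be ah bh eh e≢0 =
  go (e₀ ≟ 0#) (e₁ ≟ 0#) (e₂ ≟ 0#) (e₃ ≟ 0#)
  where
  open IsotropicPlane.Minors a₀ a₁ a₂ a₃ b₀ b₁ b₂ b₃ e₀ e₁ e₂ e₃ h₀ h₁ h₂ h₃ ab ae be ah bh eh
  go : Dec (e₀ ≡ 0#) → Dec (e₁ ≡ 0#) → Dec (e₂ ≡ 0#) → Dec (e₃ ≡ 0#) →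
    ∃[ λ′ ] h₀ ∷ h₁ ∷ h₂ ∷ h₃ ∷ [] ≡ λ′ · (e₀ ∷ e₁ ∷ e₂ ∷ e₃ ∷ [])
  go (yes refl) (yes refl) (yes refl) (yes refl) = contradiction refl e≢0
  go (no e₀≢0) _ _ _ = h₀ * e₀ , cong₂ _∷_
    (square-cancel e₀ h₀ e₀ h₀ e₀≢0 (minor-refl e₀ h₀)) (cong₂ _∷_
    (square-cancel e₀ h₀ e₁ h₁ e₀≢0 (minor-det e₀ h₀ e₁ h₁ minor₀₁)) (cong₂ _∷_
    (square-cancel e₀ h₀ e₂ h₂ e₀≢0 minor₀₂) (cong (_∷ [])
    (square-cancel e₀ h₀ e₃ h₃ e₀≢0 minor₀₃))))
  go (yes _) (no e₁≢0) _ _ = h₁ * e₁ , cong₂ _∷_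
    (square-cancel e₁ h₁ e₀ h₀ e₁≢0 (minor-swap e₀ h₀ e₁ h₁ (minor-det e₀ h₀ e₁ h₁ minor₀₁))) (cong₂ _∷_
    (square-cancel e₁ h₁ e₁ h₁ e₁≢0 (minor-refl e₁ h₁)) (cong₂ _∷_
    (square-cancel e₁ h₁ e₂ h₂ e₁≢0 minor₁₂) (cong (_∷ [])
    (square-cancel e₁ h₁ e₃ h₃ e₁≢0 minor₁₃))))
  go (yes _) (yes _) (no e₂≢0) _ = h₂ * e₂ , cong₂ _∷_
    (square-cancel e₂ h₂ e₀ h₀ e₂≢0 (minor-swap e₀ h₀ e₂ h₂ minor₀₂)) (cong₂ _∷_
    (square-cancel e₂ h₂ e₁ h₁ e₂≢0 (minor-swap e₁ h₁ e₂ h₂ minor₁₂)) (cong₂ _∷_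
    (square-cancel e₂ h₂ e₂ h₂ e₂≢0 (minor-refl e₂ h₂)) (cong (_∷ [])
    (square-cancel e₂ h₂ e₃ h₃ e₂≢0 (minor-det e₂ h₂ e₃ h₃ minor₂₃)))))
  go (yes _) (yes _) (yes _) (no e₃≢0) = h₃ * e₃ , cong₂ _∷_
    (square-cancel e₃ h₃ e₀ h₀ e₃≢0 (minor-swap e₀ h₀ e₃ h₃ minor₀₃)) (cong₂ _∷_
    (square-cancel e₃ h₃ e₁ h₁ e₃≢0 (minor-swap e₁ h₁ e₃ h₃ minor₁₃)) (cong₂ _∷_
    (square-cancel e₃ h₃ e₂ h₂ e₃≢0 (minor-swap e₂ h₂ e₃ h₃ (minor-det e₂ h₂ e₃ h₃ minor₂₃))) (cong (_∷ [])
    (square-cancel e₃ h₃ e₃ h₃ e₃≢0 (minor-refl e₃ h₃)))))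

ωP-·ˡ : ∀ c x y → ωP (c · x) y ≡ c * ωP x y
ωP-·ˡ c (x₀ ∷ x₁ ∷ x₂ ∷ x₃ ∷ []) (y₀ ∷ y₁ ∷ y₂ ∷ y₃ ∷ []) = trans
  (cong₂ _-_ (cong₂ _+_ (cong₂ _-_ (*-assoc c x₀ y₁) (*-assoc c x₁ y₀)) (*-assoc c x₂ y₃))
    (*-assoc c x₃ y₂))
  (factor c (x₀ * y₁) (x₁ * y₀) (x₂ * y₃) (x₃ * y₂))
  where
  factor : ∀ c w x y z → c * w - c * x + c * y - c * z ≡ c * (w - x + y - z)
  factor = from-yes (all? λ c → all? λ w → all? λ x → all? λ y → all? λ z →
    c * w - c * x + c * y - c * z ≟ c * (w - x + y - z))

-- The form on V in terms of projections to P

module Form {r : ℕ} (ω : F₃^ (4 ℕ.+ r) → F₃^ (4 ℕ.+ r) → F₃)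
  (isAlternating : IsAlternatingForm ω)
  (radical : ∀ x → InRadical ω x ⇔ InR x)
  (restriction : ∀ p q → ω (ιP p) (ιP q) ≡ ωP p q) where

  open IsAlternatingForm isAlternating

  ω-antisym : ∀ x y → ω x y ≡ - ω y x
  ω-antisym x y = lemma (ω x x) (ω x y) (ω y x) (ω y y) (alternating x) (alternating y) (begin
    (ω x x + ω x y) + (ω y x + ω y y)
      ≡⟨ cong₂ _+_ (+-linearʳ x x y) (+-linearʳ y x y) ⟨
    ω x (x +ᵛ y) + ω y (x +ᵛ y)   ≡⟨ +-linearˡ x y (x +ᵛ y) ⟨
    ω (x +ᵛ y) (x +ᵛ y)           ≡⟨ alternating (x +ᵛ y) ⟩
    0# ∎)
    where
    open ≡-Reasoning
    lemma : ∀ xx xy yx yy → xx ≡ 0# → yy ≡ 0# → (xx + xy) + (yx + yy) ≡ 0# → xy ≡ - yx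
    lemma = from-yes (all? λ xx → all? λ xy → all? λ yx → all? λ yy →
      (xx ≟ 0#) →-dec ((yy ≟ 0#) →-dec (((xx + xy) + (yx + yy) ≟ 0#) →-dec (xy ≟ - yx))))

  private
    decompose : ∀ (x : F₃^ (4 ℕ.+ r)) → x ≡ ιP (projP x) +ᵛ (0ᵛ {4} Vec.++ Vec.drop 4 x)
    decompose (x₀ ∷ x₁ ∷ x₂ ∷ x₃ ∷ z)
      rewrite +-identityʳ x₀ | +-identityʳ x₁ | +-identityʳ x₂ | +-identityʳ x₃ =
      cong (λ w → x₀ ∷ x₁ ∷ x₂ ∷ x₃ ∷ w) (sym (+ᵛ-identityˡ z))

    R-radicalˡ : ∀ z y → ω (0ᵛ {4} Vec.++ z) y ≡ 0#
    R-radicalˡ z = Equivalence.from (radical (0ᵛ {4} Vec.++ z)) (z , refl)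

    R-radicalʳ : ∀ x z → ω x (0ᵛ {4} Vec.++ z) ≡ 0#
    R-radicalʳ x z = trans (ω-antisym x (0ᵛ {4} Vec.++ z)) (cong (λ c → - c) (R-radicalˡ z x))

  ω-projP : ∀ x y → ω x y ≡ ωP (projP x) (projP y)
  ω-projP x y = begin
    ω x y                                  ≡⟨ cong (λ u → ω u y) (decompose x) ⟩
    ω (ιP (projP x) +ᵛ _) y                ≡⟨ +-linearˡ (ιP (projP x)) _ y ⟩
    ω (ιP (projP x)) y + ω (0ᵛ {4} Vec.++ Vec.drop 4 x) y
      ≡⟨ cong (ω (ιP (projP x)) y +_) (R-radicalˡ _ y) ⟩
    ω (ιP (projP x)) y + 0#                ≡⟨ +-identityʳ _ ⟩
    ω (ιP (projP x)) y                     ≡⟨ cong (ω (ιP (projP x))) (decompose y) ⟩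
    ω (ιP (projP x)) (ιP (projP y) +ᵛ _)   ≡⟨ +-linearʳ (ιP (projP x)) (ιP (projP y)) _ ⟩
    ω (ιP (projP x)) (ιP (projP y)) + ω (ιP (projP x)) (0ᵛ {4} Vec.++ Vec.drop 4 y)
      ≡⟨ cong₂ _+_ (restriction (projP x) (projP y)) (R-radicalʳ (ιP (projP x)) _) ⟩
    ωP (projP x) (projP y) + 0#            ≡⟨ +-identityʳ _ ⟩
    ωP (projP x) (projP y)                 ∎
    where open ≡-Reasoning

  -- Functionals are compared because the vectors are proportional only modulo the radical. The
  -- multiple is taken of `e`, whose projection is nonzero, so `h` may lie in the radical.
  proportional-vectors : ∀ a b e h → ω a b ≢ 0# →
    ω a e ≡ 0# → ω b e ≡ 0# → ω a h ≡ 0# → ω b h ≡ 0# → ω e h ≡ 0# →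
    projP e ≢ 0ᵛ → ∃[ λ′ ] ∀ l → ω h l ≡ λ′ * ω e l
  proportional-vectors a b e h ab ae be ah bh eh e≢0 = proj₁ multiple , λ l → begin
    ω h l                                   ≡⟨ ω-projP h l ⟩
    ωP (projP h) (projP l)                  ≡⟨ cong (λ u → ωP u (projP l)) (proj₂ multiple) ⟩
    ωP (proj₁ multiple · projP e) (projP l) ≡⟨ ωP-·ˡ (proj₁ multiple) (projP e) (projP l) ⟩
    proj₁ multiple * ωP (projP e) (projP l) ≡⟨ cong (proj₁ multiple *_) (ω-projP e l) ⟨
    proj₁ multiple * ω e l                  ∎
    where
    open ≡-Reasoning
    multiple : ∃[ λ′ ] projP h ≡ λ′ · projP e
    multiple = isotropic-complement (projP a) (projP b) (projP e) (projP h)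
      (subst (_≢ 0#) (ω-projP a b) ab)
      (trans (sym (ω-projP a e)) ae) (trans (sym (ω-projP b e)) be)
      (trans (sym (ω-projP a h)) ah) (trans (sym (ω-projP b h)) bh)
      (trans (sym (ω-projP e h)) eh) e≢0

  projP-zero : ∀ x y → projP x ≡ 0ᵛ → ω x y ≡ 0#
  projP-zero x y px≡0 = trans (ω-projP x y)
    (trans (cong (λ u → ωP u (projP y)) px≡0) (vanish (projP y)))
    where
    vanish : ∀ q → ωP 0ᵛ q ≡ 0#
    vanish (_ ∷ _ ∷ _ ∷ _ ∷ []) = refl

-- Live triangles

-‿involutive : ∀ x → - (- x) ≡ x
-‿involutive = from-yes (all? λ x → - (- x) ≟ x)

x≡-x⇒x≡0 : ∀ x → x ≡ - x → x ≡ 0#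
x≡-x⇒x≡0 = from-yes (all? λ x → (x ≟ - x) →-dec (x ≟ 0#))

-x≡0⇒x≡0 : ∀ x → - x ≡ 0# → x ≡ 0#
-x≡0⇒x≡0 = from-yes (all? λ x → (- x ≟ 0#) →-dec (x ≟ 0#))

≢0⇒±1 : ∀ x → x ≢ 0# → x ≡ 1# ⊎ x ≡ - 1#
≢0⇒±1 0F x≢0 = contradiction refl x≢0
≢0⇒±1 1F x≢0 = inj₁ refl
≢0⇒±1 2F x≢0 = inj₂ refl

OneOf : {X : Set} → X → X → X → X → Set
OneOf i j k e = e ≡ i ⊎ e ≡ j ⊎ e ≡ k

-- W i j stands for ω (S i) (S j).  With h = S i + S j + S k and h′ the
-- corresponding sum for i′ j′ k′, H i j k l is ω h (S l) and HH is ω h h′.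

module Triangles {I : Set} (W : I → I → F₃)
  (W-antisym : ∀ i j → W i j ≡ - W j i) where

  H : I → I → I → I → F₃
  H i j k l = W i l + W j l + W k l

  HH : I → I → I → I → I → I → F₃
  HH i j k i′ j′ k′ = H i j k i′ + H i j k j′ + H i j k k′

  -- The ordered form of a balanced triple: all six values are `W i j` along the cycle i, j, k and
  -- its negative against it.
  record Balanced₃ (i j k : I) : Set where
    constructor balanced
    field
      ij≡jk : W i j ≡ W j k
      jk≡ki : W j k ≡ W k i
      ki≢0  : W k i ≢ 0#

    jk : W j k ≡ W i j
    jk = sym ij≡jk
    ki : W k i ≡ W i j
    ki = sym (trans ij≡jk jk≡ki)
    ji : W j i ≡ - W i j
    ji = W-antisym j i
    kj : W k j ≡ - W i j
    kj = trans (W-antisym k j) (cong (λ x → - x) jk)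
    ik : W i k ≡ - W i j
    ik = trans (W-antisym i k) (cong (λ x → - x) ki)
    ij≢0 : W i j ≢ 0#
    ij≢0 = subst (_≢ 0#) ki ki≢0

  W-diag : ∀ i → W i i ≡ 0#
  W-diag i = x≡-x⇒x≡0 (W i i) (W-antisym i i)

  symm : ∀ {a b} → W a b ≡ 0# → W b a ≡ 0#
  symm {a} {b} p = trans (W-antisym b a) (cong (λ x → - x) p)

  rotate₃ : ∀ {i j k} → Balanced₃ i j k → Balanced₃ j k i
  rotate₃ K = balanced jk≡ki (trans ki refl) ij≢0
    where open Balanced₃ K

  flip₃ : ∀ {i j k} → Balanced₃ i j k → Balanced₃ i k j
  flip₃ {i} {j} {k} K = balanced (trans ik (sym kj)) (trans kj (sym ji))
    (λ ji≡0 → ij≢0 (-x≡0⇒x≡0 (W i j) (trans (sym ji) ji≡0)))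
    where open Balanced₃ K

  private
    cancel₃ : ∀ c → 0# + (- c) + c ≡ 0# × c + 0# + (- c) ≡ 0# × (- c) + c + 0# ≡ 0#
    cancel₃ = from-yes (all? λ c →
      (0# + (- c) + c ≟ 0#) ×-dec ((c + 0# + (- c) ≟ 0#) ×-dec ((- c) + c + 0# ≟ 0#)))

  H-cong : ∀ {i j k l x y z} → W i l ≡ x → W j l ≡ y → W k l ≡ z → H i j k l ≡ x + y + z
  H-cong p q r = cong₂ _+_ (cong₂ _+_ p q) r

  -- At each vertex the two other vertices contribute opposite values.
  H-self : ∀ {i j k} → Balanced₃ i j k → H i j k i ≡ 0# × H i j k j ≡ 0# × H i j k k ≡ 0#
  H-self {i} {j} {k} K =
    trans (H-cong (W-diag i) ji ki) (proj₁ (cancel₃ (W i j))) ,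
    trans (H-cong refl (W-diag j) kj) (proj₁ (proj₂ (cancel₃ (W i j)))) ,
    trans (H-cong ik jk (W-diag k)) (proj₂ (proj₂ (cancel₃ (W i j))))
    where open Balanced₃ K

  private
    +-swap₂₃ : ∀ x y z → x + y + z ≡ x + z + y
    +-swap₂₃ = from-yes (all? λ x → all? λ y → all? λ z → x + y + z ≟ x + z + y)

    +-rotate : ∀ x y z → x + y + z ≡ y + z + x
    +-rotate = from-yes (all? λ x → all? λ y → all? λ z → x + y + z ≟ y + z + x)

    neg-+ : ∀ x y z → (- x) + (- y) + (- z) ≡ - (x + y + z)
    neg-+ = from-yes (all? λ x → all? λ y → all? λ z → (- x) + (- y) + (- z) ≟ - (x + y + z))

    transpose : ∀ a b c d e f g h i →
      (a + b + c) + (d + e + f) + (g + h + i) ≡ (a + d + g) + (b + e + h) + (c + f + i)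
    transpose a b c d e f g h i = begin
      (a + b + c) + (d + e + f) + (g + h + i)
        ≡⟨ cong (_+ (g + h + i)) (+-interchange (a + b) c (d + e) f) ⟩
      (a + b + (d + e)) + (c + f) + (g + h + i)
        ≡⟨ +-interchange (a + b + (d + e)) (c + f) (g + h) i ⟩
      (a + b + (d + e)) + (g + h) + (c + f + i)
        ≡⟨ cong (λ x → x + (g + h) + (c + f + i)) (+-interchange a b d e) ⟩
      (a + d + (b + e)) + (g + h) + (c + f + i)
        ≡⟨ cong (_+ (c + f + i)) (+-interchange (a + d) (b + e) g h) ⟩
      (a + d + g) + (b + e + h) + (c + f + i) ∎
      where open ≡-Reasoning

  HH-flipˡ : ∀ i j k i′ j′ k′ → HH i k j i′ j′ k′ ≡ HH i j k i′ j′ k′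
  HH-flipˡ i j k i′ j′ k′ = cong₂ _+_ (cong₂ _+_ (eq i′) (eq j′)) (eq k′)
    where
    eq : ∀ l → H i k j l ≡ H i j k l
    eq l = +-swap₂₃ (W i l) (W k l) (W j l)

  HH-flipʳ : ∀ i j k i′ j′ k′ → HH i j k i′ k′ j′ ≡ HH i j k i′ j′ k′
  HH-flipʳ i j k i′ j′ k′ = +-swap₂₃ (H i j k i′) (H i j k k′) (H i j k j′)

  HH-rotateˡ : ∀ i j k i′ j′ k′ → HH j k i i′ j′ k′ ≡ HH i j k i′ j′ k′
  HH-rotateˡ i j k i′ j′ k′ = cong₂ _+_ (cong₂ _+_ (eq i′) (eq j′)) (eq k′)
    where
    eq : ∀ l → H j k i l ≡ H i j k l
    eq l = sym (+-rotate (W i l) (W j l) (W k l))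

  HH-rotateʳ : ∀ i j k i′ j′ k′ → HH i j k j′ k′ i′ ≡ HH i j k i′ j′ k′
  HH-rotateʳ i j k i′ j′ k′ = sym (+-rotate (H i j k i′) (H i j k j′) (H i j k k′))

  HH-antisym : ∀ i j k i′ j′ k′ → HH i j k i′ j′ k′ ≡ - HH i′ j′ k′ i j k
  HH-antisym i j k i′ j′ k′ = begin
    HH i j k i′ j′ k′
      ≡⟨ transpose (W i i′) (W j i′) (W k i′) (W i j′) (W j j′) (W k j′) (W i k′) (W j k′) (W k k′) ⟩
    (W i i′ + W i j′ + W i k′) + (W j i′ + W j j′ + W j k′) + (W k i′ + W k j′ + W k k′)
      ≡⟨ cong₂ _+_ (cong₂ _+_ (eq i) (eq j)) (eq k) ⟩
    (- H i′ j′ k′ i) + (- H i′ j′ k′ j) + (- H i′ j′ k′ k)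
      ≡⟨ neg-+ (H i′ j′ k′ i) (H i′ j′ k′ j) (H i′ j′ k′ k) ⟩
    - HH i′ j′ k′ i j k ∎
    where
    open ≡-Reasoning
    eq : ∀ l → W l i′ + W l j′ + W l k′ ≡ - H i′ j′ k′ l
    eq l = trans (cong₂ _+_ (cong₂ _+_ (W-antisym l i′) (W-antisym l j′)) (W-antisym l k′))
      (neg-+ (W i′ l) (W j′ l) (W k′ l))

  -- The vertex sum h_K vanishes on the common edge, and at `k′` the contributions of i and j
  -- cancel. Orthogonality of the vertex sums thus becomes that of the opposite vertices.
  HH-shared-edge : ∀ {i j k k′} → Balanced₃ i j k → Balanced₃ i j k′ → HH i j k i j k′ ≡ W k k′
  HH-shared-edge {i} {j} {k} {k′} K K′ = begin
    HH i j k i j k′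
      ≡⟨ cong₂ _+_ (cong₂ _+_ (proj₁ (H-self K)) (proj₁ (proj₂ (H-self K))))
           (H-cong (Balanced₃.ik K′) (Balanced₃.jk K′) refl) ⟩
    0# + 0# + ((- W i j) + W i j + W k k′)
      ≡⟨ simplify (W i j) (W k k′) ⟩
    W k k′ ∎
    where
    open ≡-Reasoning
    simplify : ∀ c s → 0# + 0# + ((- c) + c + s) ≡ s
    simplify = from-yes (all? λ c → all? λ s → 0# + 0# + ((- c) + c + s) ≟ s)

  private
    scale₃ : ∀ λ′ x y z → λ′ * x + λ′ * y + λ′ * z ≡ λ′ * (x + y + z)
    scale₃ = from-yes (all? λ λ′ → all? λ x → all? λ y → all? λ z →
      λ′ * x + λ′ * y + λ′ * z ≟ λ′ * (x + y + z))

  W-sum : ∀ l i j k → W l i + W l j + W l k ≡ - H i j k l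
  W-sum l i j k =
    trans (cong₂ _+_ (cong₂ _+_ (W-antisym l i) (W-antisym l j)) (W-antisym l k))
      (neg-+ (W i l) (W j l) (W k l))

  HH-multiple : ∀ {i j k i′ j′ k′ e} λ′ → (∀ l → H i j k l ≡ λ′ * W e l) →
    H i′ j′ k′ e ≡ 0# → HH i j k i′ j′ k′ ≡ 0#
  HH-multiple {i} {j} {k} {i′} {j′} {k′} {e} λ′ multiple He≡0 = begin
    HH i j k i′ j′ k′
      ≡⟨ cong₂ _+_ (cong₂ _+_ (multiple i′) (multiple j′)) (multiple k′) ⟩
    λ′ * W e i′ + λ′ * W e j′ + λ′ * W e k′ ≡⟨ scale₃ λ′ (W e i′) (W e j′) (W e k′) ⟩
    λ′ * (W e i′ + W e j′ + W e k′)         ≡⟨ cong (λ′ *_) (W-sum e i′ j′ k′) ⟩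
    λ′ * (- H i′ j′ k′ e)                   ≡⟨ cong (λ x → λ′ * (- x)) He≡0 ⟩
    λ′ * 0#                                 ≡⟨ *-zeroʳ λ′ ⟩
    0#                                      ∎
    where open ≡-Reasoning

  -- A triangle is live when it is balanced and its coefficient N does not
  -- vanish; C consists of the isolated indices of some block through it.

  module LiveTriangles
    (Live : I → I → I → Set)
    (shape  : ∀ {i j k} → Live i j k → Balanced₃ i j k)
    (rotate : ∀ {i j k} → Live i j k → Live j k i)
    (flip   : ∀ {i j k} → Live i j k → Live i k j)
    (another : ∀ {i j k} → Live i j k → ∃[ k′ ] k′ ≢ k × Live i j k′)
    (C : ∀ {i j k} → Live i j k → I → Set)
    (isolated : ∀ {i j k e} (K : Live i j k) → C K e →
      W e i ≡ 0# × W e j ≡ 0# × W e k ≡ 0#)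
    (proportional : ∀ {i j k e} → Live i j k → W e i ≡ 0# → W e j ≡ 0# → W e k ≡ 0# →
      ∃[ λ′ ] ∀ l → H i j k l ≡ λ′ * W e l)
    (parallel : ∀ {i j k e e′} (K : Live i j k) → C K e → C K e′ →
      ∃[ λ′ ] ∀ l → W e′ l ≡ λ′ * W e l)
    (difference : ∀ {i j k k′} → Live i j k → Live i j k′ → W k k′ ≡ 0# →
      ¬ (∀ l → H i j k l ≡ 0#) → ∃[ β ] ∀ l → W k′ l ≡ W k l + β * H i j k l)
    (meet : ∀ {i j k i′ j′ k′} (K : Live i j k) (K′ : Live i′ j′ k′) →
      ∃[ e ] (e ≡ i ⊎ e ≡ j ⊎ e ≡ k ⊎ C K e) × (e ≡ i′ ⊎ e ≡ j′ ⊎ e ≡ k′ ⊎ C K′ e))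
    where

    private
      module B {i j k} (K : Live i j k) = Balanced₃ (shape K)

      clash : ∀ {a b : I} {x y : F₃} → W a b ≡ x → W a b ≡ y → x ≢ y → ⊥
      clash p q x≢y = x≢y (trans (sym p) q)

      -≢ : ∀ x → x ≢ 0# → - x ≢ x
      -≢ = from-yes (all? λ x → ¬? (x ≟ 0#) →-dec ¬? (- x ≟ x))

      -≢0 : ∀ x → x ≢ 0# → - x ≢ 0#
      -≢0 x x≢0 = λ p → x≢0 (-x≡0⇒x≡0 x p)

      i≢j : ∀ {i j k} → Live i j k → i ≢ j
      i≢j {i} K refl = B.ij≢0 K (W-diag i)

    -- v completes the edge jk to a balanced triangle or is orthogonal to it.
    Fits : I → I → I → Set
    Fits j k v = (W v j ≡ W j k × W v k ≡ - W j k) ⊎ (W v j ≡ 0# × W v k ≡ 0#)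

    module _ {i j k j′ k′} (K : Live i j k) (K′ : Live i j′ k′)
      (HH≢0 : HH i j k i j′ k′ ≢ 0#) where

      private
        -- Since i is orthogonal to h′ and h = i + j + k, the values of ω(h′, –)
        -- at j and k determine ω(h, h′).
        cross : ∀ λ′ e → (∀ l → H i j′ k′ l ≡ λ′ * W e l) → W e j + W e k ≡ 0# → ⊥
        cross λ′ e multiple sum≡0 = HH≢0 (begin
          HH i j k i j′ k′          ≡⟨ HH-antisym i j k i j′ k′ ⟩
          - HH i j′ k′ i j k        ≡⟨ cong (λ x → - (x + H i j′ k′ j + H i j′ k′ k)) (proj₁ (H-self (shape K′))) ⟩
          - (0# + H i j′ k′ j + H i j′ k′ k)
            ≡⟨ cong (λ x → - x) (cong₂ _+_ (cong (0# +_) (multiple j)) (multiple k)) ⟩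
          - (0# + λ′ * W e j + λ′ * W e k) ≡⟨ factor λ′ (W e j) (W e k) ⟩
          - (λ′ * (W e j + W e k))  ≡⟨ cong (λ x → - (λ′ * x)) sum≡0 ⟩
          - (λ′ * 0#)               ≡⟨ cong (λ x → - x) (*-zeroʳ λ′) ⟩
          0#                        ∎)
          where
          open ≡-Reasoning
          factor : ∀ a x y → - (0# + a * x + a * y) ≡ - (a * (x + y))
          factor = from-yes (all? λ a → all? λ x → all? λ y →
            - (0# + a * x + a * y) ≟ - (a * (x + y)))

      -- The blocks of `A` and `K′` meet. If a common index is isolated in `K′`, then h_K′ is a
      -- multiple of it; being `i₁` or isolated in `A`, it has opposite or zero values at j and k,
      -- which `cross` excludes. The vertices j and k are adjacent to i, hence not isolated in `K′`,
      -- and i is not isolated in `A`. Only `j′` and `k′` remain.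
      opposite : ∀ {i₁} (A : Live i₁ j k) → i₁ ≢ i → j ≢ j′ → j ≢ k′ → k ≢ j′ → k ≢ k′ →
        (i₁ ≡ j′ ⊎ C A j′) ⊎ (i₁ ≡ k′ ⊎ C A k′)
      opposite {i₁} A i₁≢i j≢j′ j≢k′ k≢j′ k≢k′ with meet A K′
      ... | e , inj₁ refl , inj₁ refl                      = contradiction refl i₁≢i
      ... | e , inj₁ refl , inj₂ (inj₁ refl)               = inj₁ (inj₁ refl)
      ... | e , inj₁ refl , inj₂ (inj₂ (inj₁ refl))        = inj₂ (inj₁ refl)
      ... | e , inj₁ refl , inj₂ (inj₂ (inj₂ e∈C′))        =
        let p , q , r = isolated K′ e∈C′ ; λ′ , multiple = proportional K′ p q r in
        ⊥-elim (cross λ′ e multiple (trans (cong (W e j +_) (B.ik A)) (-‿inverseʳ (W e j))))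
      ... | e , inj₂ (inj₁ refl) , inj₁ refl               = contradiction refl (i≢j K)
      ... | e , inj₂ (inj₁ refl) , inj₂ (inj₁ refl)        = contradiction refl j≢j′
      ... | e , inj₂ (inj₁ refl) , inj₂ (inj₂ (inj₁ refl)) = contradiction refl j≢k′
      ... | e , inj₂ (inj₁ refl) , inj₂ (inj₂ (inj₂ e∈C′)) =
        ⊥-elim (clash (proj₁ (isolated K′ e∈C′)) (B.ji K) (λ p → -≢0 _ (B.ij≢0 K) (sym p)))
      ... | e , inj₂ (inj₂ (inj₁ refl)) , inj₁ refl        = contradiction refl (i≢j (flip K))
      ... | e , inj₂ (inj₂ (inj₁ refl)) , inj₂ (inj₁ refl) = contradiction refl k≢j′
      ... | e , inj₂ (inj₂ (inj₁ refl)) , inj₂ (inj₂ (inj₁ refl)) = contradiction refl k≢k′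
      ... | e , inj₂ (inj₂ (inj₁ refl)) , inj₂ (inj₂ (inj₂ e∈C′)) =
        ⊥-elim (B.ki≢0 K (proj₁ (isolated K′ e∈C′)))
      ... | e , inj₂ (inj₂ (inj₂ e∈C)) , inj₁ refl         =
        ⊥-elim (B.ij≢0 K (proj₁ (proj₂ (isolated A e∈C))))
      ... | e , inj₂ (inj₂ (inj₂ e∈C)) , inj₂ (inj₁ refl)  = inj₁ (inj₂ e∈C)
      ... | e , inj₂ (inj₂ (inj₂ e∈C)) , inj₂ (inj₂ (inj₁ refl)) = inj₂ (inj₂ e∈C)
      ... | e , inj₂ (inj₂ (inj₂ e∈C)) , inj₂ (inj₂ (inj₂ e∈C′)) =
        let p , q , r = isolated K′ e∈C′ ; λ′ , multiple = proportional K′ p q r in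
        ⊥-elim (cross λ′ e multiple
          (cong₂ _+_ (proj₁ (proj₂ (isolated A e∈C))) (proj₂ (proj₂ (isolated A e∈C)))))

      fits : j ≢ j′ → j ≢ k′ → k ≢ j′ → k ≢ k′ → Fits j k j′ ⊎ Fits j k k′
      fits j≢j′ j≢k′ k≢j′ k≢k′ with another (rotate K)
      ... | i₁ , i₁≢i , jki₁ with rotate (rotate jki₁)
      ...   | A with opposite A i₁≢i j≢j′ j≢k′ k≢j′ k≢k′
      ...     | inj₁ (inj₁ refl) = inj₁ (inj₁ (sym (B.jk A) , trans (B.ik A) (cong (λ x → - x) (sym (B.jk A)))))
      ...     | inj₁ (inj₂ c)    = inj₁ (inj₂ (proj₂ (isolated A c)))
      ...     | inj₂ (inj₁ refl) = inj₂ (inj₁ (sym (B.jk A) , trans (B.ik A) (cong (λ x → - x) (sym (B.jk A)))))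
      ...     | inj₂ (inj₂ c)    = inj₂ (inj₂ (proj₂ (isolated A c)))

    private
      unfit : ∀ {j k v} → W j k ≡ 1# → W v j ≡ - 1# → ¬ Fits j k v
      unfit p q (inj₁ (r , _)) = clash q (trans r p) λ()
      unfit p q (inj₂ (r , _)) = clash q r λ()

      unfit′ : ∀ {j k v} → W v j ≡ 0# → W j k ≡ 1# → W v k ≡ 1# → ¬ Fits j k v
      unfit′ p q r (inj₁ (s , _)) = clash p (trans s q) λ()
      unfit′ p q r (inj₂ (_ , s)) = clash r s λ()

      HH-value : ∀ {i j k i′ j′ k′ a b c d e f g h l} →
        W i i′ ≡ a → W j i′ ≡ b → W k i′ ≡ c →
        W i j′ ≡ d → W j j′ ≡ e → W k j′ ≡ f →
        W i k′ ≡ g → W j k′ ≡ h → W k k′ ≡ l →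
        HH i j k i′ j′ k′ ≡ (a + b + c) + (d + e + f) + (g + h + l)
      HH-value p q r s t u v w x =
        cong₂ _+_ (cong₂ _+_ (H-cong p q r) (H-cong s t u)) (H-cong v w x)

      apart : ∀ {a b c : I} {x y : F₃} → W a c ≡ x → W b c ≡ y → x ≢ y → a ≢ b
      apart p q x≢y refl = x≢y (trans (sym p) q)

      -- Let `A` replace i in `K` and `A′` replace j in `K′`. The values of `W` leave three ways for
      -- the blocks of `A` and `A′` to meet: `i₂` is `j₃` or isolated in `A′`, refuted at the vertex
      -- j; `j₃` is isolated in `A`, refuted at i; or some index isolated in both is orthogonal to
      -- i, j, k and `k′`. In the last case h_K, a multiple of that index, vanishes at `k′`, where
      -- its value is `W k k′`.
      shared-edge-1 : ∀ {i j k k′} → Live i j k → Live i j k′ →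
        W i j ≡ 1# → W k k′ ≡ 1# → ⊥
      shared-edge-1 {i} {j} {k} {k′} K K′ ij kk′
        with another (rotate K) | another (rotate (rotate K′))
      ... | i₂ , i₂≢i , jki₂ | j₃ , j₃≢j , k′ij₃
        with rotate (rotate jki₂) | rotate k′ij₃
      ...   | A | A′ = cases (meet A A′)
        where
        ji : W j i ≡ - 1#
        ji = trans (B.ji K) (cong (λ x → - x) ij)
        jk : W j k ≡ 1#
        jk = trans (B.jk K) ij
        kj : W k j ≡ - 1#
        kj = trans (B.kj K) (cong (λ x → - x) ij)
        ki : W k i ≡ 1#
        ki = trans (B.ki K) ij
        ik : W i k ≡ - 1#
        ik = trans (B.ik K) (cong (λ x → - x) ij)
        jk′ : W j k′ ≡ 1#
        jk′ = trans (B.jk K′) ij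
        k′j : W k′ j ≡ - 1#
        k′j = trans (B.kj K′) (cong (λ x → - x) ij)
        k′i : W k′ i ≡ 1#
        k′i = trans (B.ki K′) ij
        ik′ : W i k′ ≡ - 1#
        ik′ = trans (B.ik K′) (cong (λ x → - x) ij)
        k′k : W k′ k ≡ - 1#
        k′k = trans (W-antisym k′ k) (cong (λ x → - x) kk′)
        i₂j : W i₂ j ≡ 1#
        i₂j = trans (sym (B.jk A)) jk
        ki₂ : W k i₂ ≡ 1#
        ki₂ = trans (B.ki A) i₂j
        ij₃ : W i j₃ ≡ 1#
        ij₃ = trans (sym (B.ki A′)) k′i
        j₃k′ : W j₃ k′ ≡ 1#
        j₃k′ = trans (B.jk A′) ij₃
        j₃i : W j₃ i ≡ - 1#
        j₃i = trans (B.ji A′) (cong (λ x → - x) ij₃)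

        -- The triangles j k i₂ and j k′ i share only j.
        at-j : W i₂ k′ ≡ 1# × W i₂ i ≡ - 1# ⊎ W i₂ k′ ≡ 0# × W i₂ i ≡ 0# → ⊥
        at-j vals with fits (rotate A) (rotate K′) (nonzero vals)
            (apart kk′ (W-diag k′) λ()) (apart ki (W-diag i) λ())
            (apart {b = k′} i₂j k′j λ()) i₂≢i
          where
          nonzero : W i₂ k′ ≡ 1# × W i₂ i ≡ - 1# ⊎ W i₂ k′ ≡ 0# × W i₂ i ≡ 0# →
            HH j k i₂ j k′ i ≢ 0#
          nonzero (inj₁ (i₂k′ , i₂i)) p =
            contradiction (trans (sym p) (HH-value (W-diag j) kj i₂j jk′ kk′ i₂k′ ji ki i₂i)) λ()
          nonzero (inj₂ (i₂k′ , i₂i)) p =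
            contradiction (trans (sym p) (HH-value (W-diag j) kj i₂j jk′ kk′ i₂k′ ji ki i₂i)) λ()
        ... | inj₁ fit = unfit ki₂ k′k fit
        ... | inj₂ fit = unfit ki₂ ik fit

        cases : ∃[ e ] (e ≡ i₂ ⊎ e ≡ j ⊎ e ≡ k ⊎ C A e) × (e ≡ i ⊎ e ≡ j₃ ⊎ e ≡ k′ ⊎ C A′ e) → ⊥
        cases (e , inj₁ refl , inj₁ refl) = i₂≢i refl
        cases (e , inj₁ refl , inj₂ (inj₁ refl)) = at-j (inj₁ (j₃k′ , j₃i))
        cases (e , inj₁ refl , inj₂ (inj₂ (inj₁ refl))) = clash i₂j k′j λ()
        cases (e , inj₁ refl , inj₂ (inj₂ (inj₂ c′))) =
          let p , _ , r = isolated A′ c′ in at-j (inj₂ (r , p))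
        cases (e , inj₂ (inj₁ refl) , inj₁ refl) = clash ij (W-diag i) λ()
        cases (e , inj₂ (inj₁ refl) , inj₂ (inj₁ refl)) = j₃≢j refl
        cases (e , inj₂ (inj₁ refl) , inj₂ (inj₂ (inj₁ refl))) = clash ij ik′ λ()
        cases (e , inj₂ (inj₁ refl) , inj₂ (inj₂ (inj₂ c′))) = clash ji (proj₁ (isolated A′ c′)) λ()
        cases (e , inj₂ (inj₂ (inj₁ refl)) , inj₁ refl) = clash ki (W-diag i) λ()
        cases (e , inj₂ (inj₂ (inj₁ refl)) , inj₂ (inj₁ refl)) = clash ik ij₃ λ()
        cases (e , inj₂ (inj₂ (inj₁ refl)) , inj₂ (inj₂ (inj₁ refl))) = clash kk′ (W-diag k) λ()
        cases (e , inj₂ (inj₂ (inj₁ refl)) , inj₂ (inj₂ (inj₂ c′))) = clash ki (proj₁ (isolated A′ c′)) λ()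
        cases (e , inj₂ (inj₂ (inj₂ c)) , inj₁ refl) = clash ij (proj₁ (proj₂ (isolated A c))) λ()
        cases (e , inj₂ (inj₂ (inj₂ c)) , inj₂ (inj₁ refl)) =
          let e⊥i₂ , e⊥j , e⊥k = isolated A c in
          at-i e⊥j e⊥k
          where
          -- The triangles i j₃ k′ and i j k share only i.
          at-i : W e j ≡ 0# → W e k ≡ 0# → ⊥
          at-i ej ek with fits A′ K
              (λ p → contradiction (trans (sym p) (HH-value
                (W-diag i) j₃i k′i ij ej k′j ik ek k′k)) λ())
              j₃≢j (λ {refl → clash ij₃ ik λ()}) (λ {refl → clash ik′ ij λ()})
              (λ {refl → clash kk′ (W-diag k) λ()})
          ... | inj₁ fit = unfit′ (symm ej) j₃k′ jk′ fit
          ... | inj₂ fit = unfit′ (symm ek) j₃k′ kk′ fit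
        cases (e , inj₂ (inj₂ (inj₂ c)) , inj₂ (inj₂ (inj₁ refl))) = clash k′j (proj₁ (proj₂ (isolated A c))) λ()
        cases (e , inj₂ (inj₂ (inj₂ c)) , inj₂ (inj₂ (inj₂ c′))) =
          let _ , ej , ek = isolated A c ; ei , _ , ek′ = isolated A′ c′
              λ′ , multiple = proportional K ei ej ek
          in contradiction (trans (sym (H-cong ik′ jk′ kk′))
               (trans (multiple k′) (trans (cong (λ′ *_) ek′) (*-zeroʳ λ′)))) λ()

    -- The signs can be normalised: exchanging i and j negates `W i j`, exchanging the triangles
    -- negates `W k k′`.
    shared-edge : ∀ {i j k k′} → Live i j k → Live i j k′ → W k k′ ≡ 0#
    shared-edge {i} {j} {k} {k′} K K′ = decidable-stable (W k k′ ≟ 0#) λ kk′≢0 →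
      orient (≢0⇒±1 (W i j) (B.ij≢0 K)) (≢0⇒±1 (W k k′) kk′≢0)
      where
      reverse : ∀ {k} → Live i j k → Live j i k
      reverse L = rotate (rotate (flip L))
      negate : ∀ {a b} → W a b ≡ - 1# → W b a ≡ 1#
      negate {a} {b} p = trans (W-antisym b a) (cong (λ x → - x) p)
      orient : W i j ≡ 1# ⊎ W i j ≡ - 1# → W k k′ ≡ 1# ⊎ W k k′ ≡ - 1# → ⊥
      orient (inj₁ ij) (inj₁ kk′) = shared-edge-1 K K′ ij kk′
      orient (inj₁ ij) (inj₂ kk′) = shared-edge-1 K′ K ij (negate kk′)
      orient (inj₂ ij) (inj₁ kk′) = shared-edge-1 (reverse K) (reverse K′) (negate ij) kk′
      orient (inj₂ ij) (inj₂ kk′) = shared-edge-1 (reverse K′) (reverse K) (negate ij) (negate kk′)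

    -- Two live triangles with a common vertex

    module _ {i j k j′ k′} (K : Live i j k) (K′ : Live i j′ k′)
      (HH≢0 : HH i j k i j′ k′ ≢ 0#) where

      private
        -- A second common vertex would make a common edge, where `shared-edge` already gives
        -- orthogonality.
        flipped : ∀ {a b c d} (L : Live i a b) (L′ : Live i c d) →
          HH i a b i c d ≢ 0# → a ≢ c
        flipped L L′ ne refl =
          ne (trans (HH-shared-edge (shape L) (shape L′)) (shared-edge L L′))

        j≢j′ : j ≢ j′
        j≢j′ = flipped K K′ HH≢0
        j≢k′ : j ≢ k′
        j≢k′ = flipped K (flip K′) (subst (_≢ 0#) (sym (HH-flipʳ i j k i j′ k′)) HH≢0)
        k≢j′ : k ≢ j′
        k≢j′ = flipped (flip K) K′ (subst (_≢ 0#) (sym (HH-flipˡ i j k i j′ k′)) HH≢0)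
        k≢k′ : k ≢ k′
        k≢k′ = flipped (flip K) (flip K′) (subst (_≢ 0#)
          (sym (trans (HH-flipʳ i k j i j′ k′) (HH-flipˡ i j k i j′ k′))) HH≢0)

        -- The vertex sum of `A` is a multiple of v. At i it is `W i₁ i` plus two cancelling terms,
        -- and `W i₁ i` is zero since `A` and `K` share the edge jk; as v does not vanish at i, the
        -- factor is 0.
        vanishing : ∀ {i₁ v} (A : Live i₁ j k) → C A v → W v i ≢ 0# → ∀ l → H i₁ j k l ≡ 0#
        vanishing {i₁} {v} A c vi≢0 with isolated A c
        ... | vi₁ , vj , vk with proportional A vi₁ vj vk
        ...   | λ′ , multiple = λ l → trans (multiple l)
          (trans (cong (_* W v l) λ′≡0) (*-zeroˡ (W v l)))
          where
          zero-factor : ∀ λ′ x → x ≢ 0# → 0# ≡ λ′ * x → λ′ ≡ 0#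
          zero-factor = from-yes (all? λ λ′ → all? λ x →
            ¬? (x ≟ 0#) →-dec ((0# ≟ λ′ * x) →-dec (λ′ ≟ 0#)))
          sum : ∀ c → 0# + (- c) + c ≡ 0#
          sum = from-yes (all? λ c → 0# + (- c) + c ≟ 0#)
          i₁i : W i₁ i ≡ 0#
          i₁i = shared-edge (rotate A) (rotate K)
          λ′≡0 : λ′ ≡ 0#
          λ′≡0 = zero-factor λ′ (W v i) vi≢0
            (trans (sym (trans (H-cong i₁i (B.ji K) (B.ki K)) (sum (W i j)))) (multiple i))

      -- By `shared-edge`, `i₁` is orthogonal to i, so it is neither `j′` nor `k′`; by `opposite`
      -- one of these is isolated in `A`. It is not orthogonal to i, which makes the vertex sum of
      -- `A` vanish.
      replacement : ∃[ i₁ ] ∃[ A ] i₁ ≢ i × (∀ l → H i₁ j k l ≡ 0#) ×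
        (C {i₁} {j} {k} A j′ ⊎ C A k′)
      replacement with another (rotate K)
      ... | i₁ , i₁≢i , jki₁ with rotate (rotate jki₁)
      ...   | A with opposite K K′ HH≢0 A i₁≢i j≢j′ j≢k′ k≢j′ k≢k′
      ...     | inj₁ (inj₁ refl) = contradiction (shared-edge (rotate K) (rotate A)) (B.ij≢0 K′)
      ...     | inj₂ (inj₁ refl) =
        contradiction (shared-edge (rotate A) (rotate K)) (B.ki≢0 K′)
      ...     | inj₁ (inj₂ c) = i₁ , A , i₁≢i ,
        vanishing A c (λ p → B.ij≢0 K′ (symm p)) , inj₁ c
      ...     | inj₂ (inj₂ c) = i₁ , A , i₁≢i , vanishing A c (B.ki≢0 K′) , inj₂ c

    private
      -- `E` replaces k by u in `K`, then `F` replaces j by v in `E`. The blocks of `F` and `A`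
      -- meet, and the values of `W` leave two cases: v is isolated in `A`, hence parallel to `j′`;
      -- or an index isolated in both has `j′` as a multiple, although it is orthogonal to i and
      -- `j′` is not.
      module Crossing {i j k j′ k′ i₁ u v} (K : Live i j k) (K′ : Live i j′ k′)
        (A : Live i₁ j k) (E : Live i j u) (F : Live i v u) (i₁≢i : i₁ ≢ i) (u≢k : u ≢ k)
        (v≢j : v ≢ j) (HA≡0 : ∀ l → H i₁ j k l ≡ 0#)
        (j′∈CA : C A j′) (jj′ : W j j′ ≡ 0#) (jk′ : W j k′ ≡ 0#)
        (β : F₃) (uβ : ∀ l → W u l ≡ W k l + β * H i j k l) where

        c c′ : F₃
        c  = W i j
        c′ = W i j′
        c≢0 : c ≢ 0#
        c≢0 = B.ij≢0 K
        c′≢0 : c′ ≢ 0#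
        c′≢0 = B.ij≢0 K′
        ku : W k u ≡ 0#
        ku = shared-edge K E
        ju : W j u ≡ c
        ju = B.jk E
        ui : W u i ≡ c
        ui = B.ki E
        iv : W i v ≡ c
        iv = trans (sym (B.ki F)) ui
        vi : W v i ≡ - c
        vi = trans (B.ji F) (cong (λ x → - x) iv)
        vu : W v u ≡ c
        vu = trans (B.jk F) iv
        j′k : W j′ k ≡ 0#
        j′k = proj₂ (proj₂ (isolated A j′∈CA))

        last : ∀ x y z → x + y + z ≡ 0# → x ≡ - (y + z)
        last = from-yes (all? λ x → all? λ y → all? λ z →
          (x + y + z ≟ 0#) →-dec (x ≟ - (y + z)))

        neg-sum : ∀ c → - ((- c) + c) ≡ 0#
        neg-sum = from-yes (all? λ c → - ((- c) + c) ≟ 0#)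

        i₁i : W i₁ i ≡ 0#
        i₁i = trans (last (W i₁ i) (W j i) (W k i) (HA≡0 i))
          (trans (cong₂ (λ x y → - (x + y)) (B.ji K) (B.ki K)) (neg-sum c))
        i₁u : W i₁ u ≡ - c
        i₁u = trans (last (W i₁ u) (W j u) (W k u) (HA≡0 u))
          (cong (λ x → - x) (trans (cong₂ _+_ ju ku) (+-identityʳ c)))

        -- With v = m j′ the value of u at `j′` forces β = -1, and this determines u at `k′`;
        -- neither value is zero. They give ω(h_F, h_K′) = m c′ = c, so `replacement` applies to `F`
        -- and makes `j′` or `k′` orthogonal to u, a contradiction.
        module Parallel (m : F₃) (vm : ∀ l → W v l ≡ m * W j′ l) where

          -c≡-mc′ : - c ≡ m * (- c′)
          -c≡-mc′ = trans (sym vi) (trans (vm i) (cong (m *_) (B.ji K′)))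

          quotient : ∀ c c′ m x → - c ≡ m * (- c′) → c ≡ m * x → c ≢ 0# → x ≡ c′
          quotient = from-yes (all? λ c → all? λ c′ → all? λ m → all? λ x →
            (- c ≟ m * (- c′)) →-dec ((c ≟ m * x) →-dec (¬? (c ≟ 0#) →-dec (x ≟ c′))))

          j′u : W j′ u ≡ c′
          j′u = quotient c c′ m (W j′ u) -c≡-mc′ (trans (sym vu) (vm u)) c≢0
          uj′ : W u j′ ≡ - c′
          uj′ = trans (W-antisym u j′) (cong (λ x → - x) j′u)

          c+0+0 : ∀ c → c + 0# + 0# ≡ c
          c+0+0 = from-yes (all? λ c → c + 0# + 0# ≟ c)
          solve-β : ∀ β c → - c ≡ 0# + β * c → c ≢ 0# → β ≡ - 1#
          solve-β = from-yes (all? λ β → all? λ c →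
            (- c ≟ 0# + β * c) →-dec (¬? (c ≟ 0#) →-dec (β ≟ - 1#)))
          Hj′ : H i j k j′ ≡ c′
          Hj′ = trans (H-cong {i} {j} {k} {j′} {c′} {0#} {0#} refl jj′ (symm j′k)) (c+0+0 c′)
          β≡-1 : β ≡ - 1#
          β≡-1 = solve-β β c′ (begin
            - c′                        ≡⟨ uj′ ⟨
            W u j′                      ≡⟨ uβ j′ ⟩
            W k j′ + β * H i j k j′     ≡⟨ cong₂ (λ x y → x + β * y) (symm j′k) Hj′ ⟩
            0# + β * c′                 ∎) c′≢0
            where open ≡-Reasoning

          solve-k′ : ∀ q c → q + (- 1#) * ((- c) + 0# + q) ≡ c
          solve-k′ = from-yes (all? λ q → all? λ c → q + (- 1#) * ((- c) + 0# + q) ≟ c)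
          Hk′ : H i j k k′ ≡ (- c′) + 0# + W k k′
          Hk′ = H-cong {i} {j} {k} {k′} (B.ik K′) jk′ refl
          uk′ : W u k′ ≡ c′
          uk′ = begin
            W u k′                                          ≡⟨ uβ k′ ⟩
            W k k′ + β * H i j k k′                         ≡⟨ cong₂ (λ x y → W k k′ + x * y) β≡-1 Hk′ ⟩
            W k k′ + (- 1#) * ((- c′) + 0# + W k k′)        ≡⟨ solve-k′ (W k k′) c′ ⟩
            c′                                              ∎
            where open ≡-Reasoning

          vj′ : W v j′ ≡ 0#
          vj′ = trans (vm j′) (trans (cong (m *_) (W-diag j′)) (*-zeroʳ m))
          vk′ : W v k′ ≡ m * c′
          vk′ = trans (vm k′) (cong (m *_) (B.jk K′))

          value : F₃ → F₃ → F₃ → F₃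
          value c c′ m = (0# + (- c) + c) + (c′ + 0# + (- c′)) + ((- c′) + m * c′ + c′)

          HHF : HH i v u i j′ k′ ≡ value c c′ m
          HHF = HH-value {i} {v} {u} {i} {j′} {k′} {0#} { - c} {c} {c′} {0#} { - c′} { - c′} {m * c′} {c′}
            (W-diag i) vi ui refl vj′ uj′ (B.ik K′) vk′ uk′

          value≢0 : ∀ c c′ m → - c ≡ m * (- c′) → c ≢ 0# → value c c′ m ≢ 0#
          value≢0 = from-yes (all? λ c → all? λ c′ → all? λ m → (- c ≟ m * (- c′)) →-dec
            (¬? (c ≟ 0#) →-dec ¬? (value c c′ m ≟ 0#)))

          HHF≢0 : HH i v u i j′ k′ ≢ 0#
          HHF≢0 p = value≢0 c c′ m -c≡-mc′ c≢0 (trans (sym HHF) p)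

          finish : ∃[ i₂ ] ∃[ A′ ] i₂ ≢ i × (∀ l → H i₂ v u l ≡ 0#) ×
            (C {i₂} {v} {u} A′ j′ ⊎ C A′ k′) → ⊥
          finish (_ , A′ , _ , _ , inj₁ d) =
            clash (proj₂ (proj₂ (isolated A′ d))) j′u (λ p → c′≢0 (sym p))
          finish (_ , A′ , _ , _ , inj₂ d) =
            clash (symm (proj₂ (proj₂ (isolated A′ d)))) uk′ (λ p → c′≢0 (sym p))

          impossible : ⊥
          impossible = finish (replacement F K′ HHF≢0)

        cases : ∃[ e ] (e ≡ i ⊎ e ≡ v ⊎ e ≡ u ⊎ C F e) × (e ≡ i₁ ⊎ e ≡ j ⊎ e ≡ k ⊎ C A e) → ⊥
        cases (e , inj₁ refl , inj₁ p) = i₁≢i (sym p)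
        cases (e , inj₁ refl , inj₂ (inj₁ refl)) = c≢0 (W-diag i)
        cases (e , inj₁ refl , inj₂ (inj₂ (inj₁ refl))) = B.ki≢0 K (W-diag i)
        cases (e , inj₁ refl , inj₂ (inj₂ (inj₂ d))) = c≢0 (proj₁ (proj₂ (isolated A d)))
        cases (e , inj₂ (inj₁ refl) , inj₁ refl) = clash (symm i₁i) iv (λ p → c≢0 (sym p))
        cases (e , inj₂ (inj₁ refl) , inj₂ (inj₁ p)) = v≢j p
        cases (e , inj₂ (inj₁ refl) , inj₂ (inj₂ (inj₁ refl))) = clash (B.ik K) iv (-≢ c c≢0)
        cases (e , inj₂ (inj₁ refl) , inj₂ (inj₂ (inj₂ d))) =
          let m , vm = parallel A j′∈CA d in Parallel.impossible m vm
        cases (e , inj₂ (inj₂ (inj₁ refl)) , inj₁ refl) = clash i₁i ui (λ p → c≢0 (sym p))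
        cases (e , inj₂ (inj₂ (inj₁ refl)) , inj₂ (inj₁ refl)) = clash ju (W-diag j) c≢0
        cases (e , inj₂ (inj₂ (inj₁ refl)) , inj₂ (inj₂ (inj₁ p))) = u≢k p
        cases (e , inj₂ (inj₂ (inj₁ refl)) , inj₂ (inj₂ (inj₂ d))) =
          clash (symm (proj₁ (proj₂ (isolated A d)))) ju (λ p → c≢0 (sym p))
        cases (e , inj₂ (inj₂ (inj₂ d)) , inj₁ refl) =
          clash (proj₂ (proj₂ (isolated F d))) i₁u (λ p → -≢0 c c≢0 (sym p))
        cases (e , inj₂ (inj₂ (inj₂ d)) , inj₂ (inj₁ refl)) = c≢0 (symm (proj₁ (isolated F d)))
        cases (e , inj₂ (inj₂ (inj₂ d)) , inj₂ (inj₂ (inj₁ refl))) = B.ki≢0 K (proj₁ (isolated F d))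
        cases (e , inj₂ (inj₂ (inj₂ d)) , inj₂ (inj₂ (inj₂ d′))) =
          let m , j′m = parallel A d′ j′∈CA
          in clash (trans (j′m i) (trans (cong (m *_) (proj₁ (isolated F d))) (*-zeroʳ m)))
               (B.ji K′) (λ p → -≢0 c′ c′≢0 (sym p))

      no-crossing-at : ∀ {i j k j′ k′ i₁} (K : Live i j k) (K′ : Live i j′ k′) →
        HH i j k i j′ k′ ≢ 0# → (A : Live i₁ j k) → i₁ ≢ i → (∀ l → H i₁ j k l ≡ 0#) →
        C A j′ → W j j′ ≡ 0# → W j k′ ≡ 0# → ⊥
      no-crossing-at {i} {j} {k} {j′} {k′} K K′ HH≢0 A i₁≢i HA≡0 j′∈CA jj′ jk′ =
        Crossing.cases K K′ A E F i₁≢i (proj₁ (proj₂ (another K)))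
          (proj₁ (proj₂ (another (rotate (rotate E))))) HA≡0 j′∈CA jj′ jk′
          (proj₁ multiple) (proj₂ multiple) (meet F A)
        where
        u v : I
        u = proj₁ (another K)
        E : Live i j u
        E = proj₂ (proj₂ (another K))
        v = proj₁ (another (rotate (rotate E)))
        F : Live i v u
        F = rotate (proj₂ (proj₂ (another (rotate (rotate E)))))
        multiple : ∃[ β ] ∀ l → W u l ≡ W k l + β * H i j k l
        -- If h_K vanished as a functional, so would ω(h_K, h_K′).
        multiple = difference K E (shared-edge K E)
          (λ h≡0 → HH≢0 (cong₂ _+_ (cong₂ _+_ (h≡0 i) (h≡0 j′)) (h≡0 k′)))

      Replacement : ∀ {i j k} → I → I → Live i j k → Set
      Replacement {i} {j} {k} j′ k′ _ = ∃[ i₁ ] ∃[ A ] i₁ ≢ i × (∀ l → H i₁ j k l ≡ 0#) ×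
        (C {i₁} {j} {k} A j′ ⊎ C A k′)

      -- `replacement` is used both ways. Applied to `K′` it makes j or k orthogonal to `j′` and
      -- `k′`; applied to `K` it yields `A` with `j′` or `k′` isolated. Flips reduce to j and `j′`.
      no-crossing : ∀ {i j k j′ k′} → Live i j k → Live i j′ k′ → ¬ HH i j k i j′ k′ ≢ 0#
      no-crossing {i} {j} {k} {j′} {k′} K K′ HH≢0 = outer (replacement K′ K HH≢0′)
        where
        HH≢0′ : HH i j′ k′ i j k ≢ 0#
        HH≢0′ p = HH≢0 (trans (HH-antisym i j k i j′ k′) (cong (λ x → - x) p))

        inner : ∀ {j k} (K : Live i j k) → HH i j k i j′ k′ ≢ 0# →
          W j j′ ≡ 0# → W j k′ ≡ 0# → Replacement j′ k′ K → ⊥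
        inner {j} {k} K ne p q (_ , A , i₁≢i , HA≡0 , inj₁ d) =
          no-crossing-at K K′ ne A i₁≢i HA≡0 d p q
        inner {j} {k} K ne p q (_ , A , i₁≢i , HA≡0 , inj₂ d) =
          no-crossing-at K (flip K′) (subst (_≢ 0#) (sym (HH-flipʳ i j k i j′ k′)) ne)
            A i₁≢i HA≡0 d q p

        HH≢0ˡ : HH i k j i j′ k′ ≢ 0#
        HH≢0ˡ = subst (_≢ 0#) (sym (HH-flipˡ i j k i j′ k′)) HH≢0

        outer : Replacement j k K′ → ⊥
        outer (_ , A′ , _ , _ , inj₁ d) =
          inner K HH≢0 (proj₁ (proj₂ (isolated A′ d))) (proj₂ (proj₂ (isolated A′ d)))
            (replacement K K′ HH≢0)
        outer (_ , A′ , _ , _ , inj₂ d) =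
          inner (flip K) HH≢0ˡ (proj₁ (proj₂ (isolated A′ d))) (proj₂ (proj₂ (isolated A′ d)))
            (replacement (flip K) K′ HH≢0ˡ)

    -- Let e be common to the two blocks. If it is isolated in one, the vertex sum of that triangle
    -- is a multiple of e, and e is orthogonal to the other vertex sum. If it is a vertex of both,
    -- the triangles are rotated to begin with e and cannot cross.
    coherent : ∀ {i j k i′ j′ k′} → Live i j k → Live i′ j′ k′ → HH i j k i′ j′ k′ ≡ 0#
    coherent {i} {j} {k} {i′} {j′} {k′} K K′ =
      decidable-stable (HH i j k i′ j′ k′ ≟ 0#) λ HH≢0 →
        let _ , p , q = meet K K′
        in cases HH≢0 (vertex-or-isolated K p) (vertex-or-isolated K′ q)
      where
      core : ∀ {a b c e} → Live a b c → OneOf a b c e → H a b c e ≡ 0#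
      core L (inj₁ refl)        = proj₁ (H-self (shape L))
      core L (inj₂ (inj₁ refl)) = proj₁ (proj₂ (H-self (shape L)))
      core L (inj₂ (inj₂ refl)) = proj₂ (proj₂ (H-self (shape L)))

      isolated-H : ∀ {a b c e} (L : Live a b c) → C L e → H a b c e ≡ 0#
      isolated-H L d = let p , q , r = isolated L d in H-cong (symm p) (symm q) (symm r)

      vertex-or-isolated : ∀ {a b c e} (L : Live a b c) → e ≡ a ⊎ e ≡ b ⊎ e ≡ c ⊎ C L e →
        OneOf a b c e ⊎ C L e
      vertex-or-isolated L (inj₁ p)               = inj₁ (inj₁ p)
      vertex-or-isolated L (inj₂ (inj₁ p))        = inj₁ (inj₂ (inj₁ p))
      vertex-or-isolated L (inj₂ (inj₂ (inj₁ p))) = inj₁ (inj₂ (inj₂ p))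
      vertex-or-isolated L (inj₂ (inj₂ (inj₂ d))) = inj₂ d

      member : ∀ {a b c e} (L : Live a b c) → OneOf a b c e ⊎ C L e → H a b c e ≡ 0#
      member L (inj₁ p) = core L p
      member L (inj₂ d) = isolated-H L d

      orthogonalˡ : ∀ {a b c a′ b′ c′ e} (L : Live a b c) → C L e → H a′ b′ c′ e ≡ 0# →
        HH a b c a′ b′ c′ ≡ 0#
      orthogonalˡ L d e⊥ = let p , q , r = isolated L d ; λ′ , multiple = proportional L p q r in
        HH-multiple λ′ multiple e⊥

      orthogonalʳ : ∀ {a b c a′ b′ c′ e} (L : Live a′ b′ c′) → C L e → H a b c e ≡ 0# →
        HH a b c a′ b′ c′ ≡ 0#
      orthogonalʳ {a} {b} {c} {a′} {b′} {c′} L d e⊥ =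
        trans (HH-antisym a b c a′ b′ c′) (cong (λ x → - x) (orthogonalˡ L d e⊥))

      Front : I → I → I → I → Set
      Front a b c e = ∃[ x ] ∃[ y ] Live e x y ×
        (∀ p q r → HH e x y p q r ≡ HH a b c p q r) × (∀ p q r → HH p q r e x y ≡ HH p q r a b c)

      toFront : ∀ {a b c e} → Live a b c → OneOf a b c e → Front a b c e
      toFront {a} {b} {c} L (inj₁ refl) = b , c , L , (λ _ _ _ → refl) , (λ _ _ _ → refl)
      toFront {a} {b} {c} L (inj₂ (inj₁ refl)) = c , a , rotate L , HH-rotateˡ a b c ,
        (λ p q r → HH-rotateʳ p q r a b c)
      toFront {a} {b} {c} L (inj₂ (inj₂ refl)) = a , b , rotate (rotate L) ,
        (λ p q r → trans (HH-rotateˡ b c a p q r) (HH-rotateˡ a b c p q r)) ,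
        (λ p q r → trans (HH-rotateʳ p q r b c a) (HH-rotateʳ p q r a b c))

      common : ∀ {e} → OneOf i j k e → OneOf i′ j′ k′ e → HH i j k i′ j′ k′ ≢ 0# → ⊥
      common {e} p q HH≢0 = front (toFront K p) (toFront K′ q)
        where
        front : Front i j k e → Front i′ j′ k′ e → ⊥
        front (x , y , L , eqˡ , _) (x′ , y′ , L′ , _ , eqʳ) =
          no-crossing L L′ (subst (_≢ 0#) (sym (trans (eqʳ e x y) (eqˡ i′ j′ k′))) HH≢0)

      cases : ∀ {e} → HH i j k i′ j′ k′ ≢ 0# →
        OneOf i j k e ⊎ C K e → OneOf i′ j′ k′ e ⊎ C K′ e → ⊥
      cases HH≢0 (inj₂ d) q        = HH≢0 (orthogonalˡ K d (member K′ q))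
      cases HH≢0 p        (inj₂ d) = HH≢0 (orthogonalʳ K′ d (member K p))
      cases HH≢0 (inj₁ p) (inj₁ q) = common p q HH≢0

-- Sums over subsets and triples of indices

first : ∀ {n} {P : Fin n → Set} → Decidable P → Maybe (Fin n)
first {zero}  P? = nothing
first {suc n} P? with P? zero
... | yes _ = just zero
... | no  _ = Maybe.map suc (first (P? ∘ suc))

-- This lets different edges of a triangle find the same separating index.
first-cong : ∀ {n} {P Q : Fin n → Set} (P? : Decidable P) (Q? : Decidable Q) →
  (∀ e → P e → Q e) → (∀ e → Q e → P e) → first P? ≡ first Q?
first-cong {zero}  P? Q? P⊆Q Q⊆P = refl
first-cong {suc n} P? Q? P⊆Q Q⊆P with P? zero | Q? zero
... | yes _ | yes _ = refl
... | yes p | no ¬q = contradiction (P⊆Q zero p) ¬q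
... | no ¬p | yes q = contradiction (Q⊆P zero q) ¬p
... | no _  | no _  = cong (Maybe.map suc) (first-cong (P? ∘ suc) (Q? ∘ suc) (P⊆Q ∘ suc) (Q⊆P ∘ suc))

first-exists : ∀ {n} {P : Fin n → Set} (P? : Decidable P) {e} → P e →
  ∃[ e₀ ] first P? ≡ just e₀ × P e₀
first-exists {suc n} P? {e} pe with P? zero
... | yes p = zero , refl , p
first-exists {suc n} P? {zero}  pe | no ¬p = contradiction pe ¬p
first-exists {suc n} P? {suc e} pe | no ¬p with first-exists (P? ∘ suc) pe
... | e₀ , eq , pe₀ = suc e₀ , cong (Maybe.map suc) eq , pe₀

∑-≢0 : ∀ (xs : List X) (f : X → F₃) → ∑ xs f ≢ 0# → ∃[ x ] f x ≢ 0#
∑-≢0 []       f ne = contradiction refl ne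
∑-≢0 (x ∷ xs) f ne with f x ≟ 0#
... | no  fx≢0 = x , fx≢0
... | yes fx≡0 = ∑-≢0 xs f λ p → ne (cong₂ _+_ fx≡0 p)

_≟ˢ_ : (p q : Subset n) → Dec (p ≡ q)
_≟ˢ_ = ≡-dec _≟ᵇ_

∑-subset : ∀ (K₀ : Subset n) (f : Subset n → F₃) →
  ∑ (subsets n) (λ K → ⟦ K ≟ˢ K₀ ⟧ * f K) ≡ f K₀
∑-subset {zero} [] f = trans (+-identityʳ (1# * f [])) (*-identityˡ (f []))
∑-subset {suc n} (x ∷ K₀) f = begin
  ∑ (subsets (suc n)) t              ≡⟨ ∑-++ (map (outside ∷_) (subsets n)) _ t ⟩
  _                                  ≡⟨ cong₂ _+_ (∑-map (outside ∷_) (subsets n) t) (∑-map (inside ∷_) (subsets n) t) ⟩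
  ∑ (subsets n) (λ K → t (outside ∷ K)) + ∑ (subsets n) (λ K → t (inside ∷ K))
                                     ≡⟨ halves x refl ⟩
  f (x ∷ K₀)                         ∎
  where
  open ≡-Reasoning
  t : Subset (suc n) → F₃
  t K = ⟦ K ≟ˢ (x ∷ K₀) ⟧ * f K
  here-≡ : ∀ K → ⟦ (x ∷ K) ≟ˢ (x ∷ K₀) ⟧ * f (x ∷ K) ≡ ⟦ K ≟ˢ K₀ ⟧ * f (x ∷ K)
  here-≡ K = cong (_* f (x ∷ K)) (⟦⟧-⇔ ((x ∷ K) ≟ˢ (x ∷ K₀)) (K ≟ˢ K₀) Vecₚ.∷-injectiveʳ (cong (x ∷_)))
  here-≢ : ∀ {y} → y ≢ x → ∀ K → ⟦ (y ∷ K) ≟ˢ (x ∷ K₀) ⟧ * f (y ∷ K) ≡ 0#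
  here-≢ {y} y≢x K = trans (cong (_* f (y ∷ K)) (⟦⟧-no ((y ∷ K) ≟ˢ (x ∷ K₀)) (y≢x ∘ Vecₚ.∷-injectiveˡ)))
    (*-zeroˡ (f (y ∷ K)))
  halves : ∀ y → y ≡ x →
    ∑ (subsets n) (λ K → t (outside ∷ K)) + ∑ (subsets n) (λ K → t (inside ∷ K)) ≡ f (x ∷ K₀)
  halves outside refl = trans (cong₂ _+_
    (trans (∑-cong (subsets n) here-≡) (∑-subset K₀ (f ∘ (outside ∷_))))
    (∑-zero (subsets n) (here-≢ {inside} λ()))) (+-identityʳ (f (x ∷ K₀)))
  halves inside refl = trans (cong₂ _+_ (∑-zero (subsets n) (here-≢ {outside} λ()))
    (trans (∑-cong (subsets n) here-≡) (∑-subset K₀ (f ∘ (inside ∷_))))) (+-identityˡ (f (x ∷ K₀)))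

∑-unique-subset : ∀ {P : Subset n → Set} (P? : Decidable P) (f : Subset n → F₃) {K₀} →
  P K₀ → (∀ K → P K → K ≡ K₀) → ∑ (subsets n) (λ K → ⟦ P? K ⟧ * f K) ≡ f K₀
∑-unique-subset {n} P? f {K₀} PK₀ unique = trans
  (∑-cong (subsets n) λ K → cong (_* f K)
    (⟦⟧-⇔ (P? K) (K ≟ˢ K₀) (unique K) λ {refl → PK₀}))
  (∑-subset K₀ f)

∑-fin : ∀ (i₀ : Fin n) (f : Fin n → F₃) → ∑ (allFin n) (λ i → ⟦ i ≟ i₀ ⟧ * f i) ≡ f i₀
∑-fin {suc n} i₀ f = trans (cong (⟦ zero ≟ i₀ ⟧ * f zero +_) shift) (split i₀)
  where
  shift : ∑ (tabulate suc) (λ i → ⟦ i ≟ i₀ ⟧ * f i) ≡ ∑ (allFin n) (λ i → ⟦ suc i ≟ i₀ ⟧ * f (suc i))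
  shift = trans (cong (λ xs → ∑ xs (λ i → ⟦ i ≟ i₀ ⟧ * f i)) (sym (Listₚ.map-tabulate (λ i → i) suc)))
    (∑-map suc (allFin n) _)
  split : ∀ i₀ → ⟦ zero ≟ i₀ ⟧ * f zero + ∑ (allFin n) (λ i → ⟦ suc i ≟ i₀ ⟧ * f (suc i)) ≡ f i₀
  split zero = trans (cong₂ _+_ (*-identityˡ (f zero)) (∑-zero (allFin n) λ i → *-zeroˡ (f (suc i))))
    (+-identityʳ (f zero))
  split (suc i₀) = trans (cong₂ _+_ (*-zeroˡ (f zero)) (trans
    (∑-cong (allFin n) λ i → cong (_* f (suc i))
      (⟦⟧-⇔ (suc i ≟ suc i₀) (i ≟ i₀) Finₚ.suc-injective (cong suc)))
    (∑-fin i₀ (f ∘ suc)))) (+-identityˡ (f (suc i₀)))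

triple : Fin n → Fin n → Fin n → Subset n
triple i j k = ⁅ i ⁆ ∪ ⁅ j ⁆ ∪ ⁅ k ⁆

∈-triple⁻ : ∀ {i j k e : Fin n} → e ∈ triple i j k → OneOf i j k e
∈-triple⁻ {i = i} {j} {k} e∈ with x∈p∪q⁻ ⁅ i ⁆ (⁅ j ⁆ ∪ ⁅ k ⁆) e∈
... | inj₁ p = inj₁ (x∈⁅y⁆⇒x≡y i p)
... | inj₂ q with x∈p∪q⁻ ⁅ j ⁆ ⁅ k ⁆ q
...   | inj₁ p = inj₂ (inj₁ (x∈⁅y⁆⇒x≡y j p))
...   | inj₂ p = inj₂ (inj₂ (x∈⁅y⁆⇒x≡y k p))

∈-triple⁺ : ∀ {i j k e : Fin n} → OneOf i j k e → e ∈ triple i j k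
∈-triple⁺ {i = i}         (inj₁ refl)        = x∈p∪q⁺ (inj₁ (x∈⁅x⁆ i))
∈-triple⁺ {j = j}         (inj₂ (inj₁ refl)) = x∈p∪q⁺ (inj₂ (x∈p∪q⁺ (inj₁ (x∈⁅x⁆ j))))
∈-triple⁺ {j = j} {k = k} (inj₂ (inj₂ refl)) = x∈p∪q⁺ (inj₂ (x∈p∪q⁺ {p = ⁅ j ⁆} (inj₂ (x∈⁅x⁆ k))))

triple-⊆ : ∀ {i j k : Fin n} {B} → i ∈ B → j ∈ B → k ∈ B → triple i j k ⊆ B
triple-⊆ i∈ j∈ k∈ e∈ with ∈-triple⁻ e∈
... | inj₁ refl        = i∈
... | inj₂ (inj₁ refl) = j∈
... | inj₂ (inj₂ refl) = k∈

triple-rotate : ∀ (i j k : Fin n) → triple j k i ≡ triple i j k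
triple-rotate i j k = ⊆-antisym
  (triple-⊆ (∈-triple⁺ (inj₂ (inj₁ refl))) (∈-triple⁺ (inj₂ (inj₂ refl))) (∈-triple⁺ (inj₁ refl)))
  (triple-⊆ (∈-triple⁺ (inj₂ (inj₂ refl))) (∈-triple⁺ (inj₁ refl)) (∈-triple⁺ (inj₂ (inj₁ refl))))

triple-flip : ∀ (i j k : Fin n) → triple i k j ≡ triple i j k
triple-flip i j k = ⊆-antisym
  (triple-⊆ (∈-triple⁺ (inj₁ refl)) (∈-triple⁺ (inj₂ (inj₂ refl))) (∈-triple⁺ (inj₂ (inj₁ refl))))
  (triple-⊆ (∈-triple⁺ (inj₁ refl)) (∈-triple⁺ (inj₂ (inj₂ refl))) (∈-triple⁺ (inj₂ (inj₁ refl))))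

place : ∀ {a b c e : Fin n} → OneOf a b c e → Fin 3
place (inj₁ _)        = 0F
place (inj₂ (inj₁ _)) = 1F
place (inj₂ (inj₂ _)) = 2F

place-injective : ∀ {a b c e f : Fin n} (p : OneOf a b c e) (q : OneOf a b c f) →
  place p ≡ place q → e ≡ f
place-injective (inj₁ refl)        (inj₁ refl)        _ = refl
place-injective (inj₁ _)           (inj₂ (inj₁ _))    ()
place-injective (inj₁ _)           (inj₂ (inj₂ _))    ()
place-injective (inj₂ (inj₁ _))    (inj₁ _)           ()
place-injective (inj₂ (inj₁ _))    (inj₂ (inj₂ _))    ()
place-injective (inj₂ (inj₂ _))    (inj₁ _)           ()
place-injective (inj₂ (inj₂ _))    (inj₂ (inj₁ _))    ()
place-injective (inj₂ (inj₁ refl)) (inj₂ (inj₁ refl)) _ = refl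
place-injective (inj₂ (inj₂ refl)) (inj₂ (inj₂ refl)) _ = refl

no-four-in-triple : ∀ {a b c : Fin n} (f : Fin 4 → Fin n) → (∀ s → f s ∈ triple a b c) →
  (∀ {s t} → s Fin.< t → f s ≢ f t) → ⊥
no-four-in-triple f f∈ distinct
  with pigeonhole (ℕₚ.n<1+n 3) (λ s → place (∈-triple⁻ (f∈ s)))
... | s , t , s<t , eq = distinct s<t (place-injective (∈-triple⁻ (f∈ s)) (∈-triple⁻ (f∈ t)) eq)

no-fourth : ∀ {a b c w x y z : Fin n} →
  w ∈ triple a b c → x ∈ triple a b c → y ∈ triple a b c → z ∈ triple a b c →
  x ≢ y → y ≢ z → z ≢ x → w ≢ x → w ≢ y → w ≢ z → ⊥
no-fourth {n} {a} {b} {c} {w} {x} {y} {z} w∈ x∈ y∈ z∈ xy yz zx wx wy wz =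
  no-four-in-triple f f∈ distinct
  where
  f : Fin 4 → Fin n
  f 0F = w
  f 1F = x
  f 2F = y
  f 3F = z
  f∈ : ∀ s → f s ∈ triple a b c
  f∈ 0F = w∈
  f∈ 1F = x∈
  f∈ 2F = y∈
  f∈ 3F = z∈
  distinct : ∀ {s t} → s Fin.< t → f s ≢ f t
  distinct {0F} {1F} _ = wx
  distinct {0F} {2F} _ = wy
  distinct {0F} {3F} _ = wz
  distinct {1F} {2F} _ = xy
  distinct {1F} {3F} _ = λ p → zx (sym p)
  distinct {2F} {3F} _ = yz
  distinct {1F} {1F} s<t _ = ℕₚ.<-irrefl refl s<t
  distinct {2F} {2F} s<t _ = ℕₚ.<-irrefl refl s<t
  distinct {3F} {3F} s<t _ = ℕₚ.<-irrefl refl s<t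
  distinct {2F} {1F} s<t _ = ℕₚ.<-asym s<t (ℕ.s≤s (ℕ.s≤s ℕ.z≤n))
  distinct {3F} {1F} s<t _ = ℕₚ.<-asym s<t (ℕ.s≤s (ℕ.s≤s ℕ.z≤n))
  distinct {3F} {2F} s<t _ = ℕₚ.<-asym s<t (ℕ.s≤s (ℕ.s≤s (ℕ.s≤s ℕ.z≤n)))

-- Vector-zero blocks of a No-full list

blockSum-∪ : ∀ {a n} (ω : F₃^ a → F₃^ a → F₃) (S : Vector (F₃^ a) n) (p q : Subset n) →
  (∀ e → e ∈ p → e ∈ q → ⊥) → blockSum ω S (p ∪ q) ≡ blockSum ω S p +ᵛ blockSum ω S q
blockSum-∪ ω S [] [] _ = sym (+ᵛ-identityˡ 0ᵛ)
blockSum-∪ ω S (inside ∷ p) (inside ∷ q) disjoint = ⊥-elim (disjoint zero here here)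
blockSum-∪ ω S (inside ∷ p) (outside ∷ q) disjoint = begin
  S zero +ᵛ blockSum ω (S ∘ suc) (p ∪ q) ≡⟨ cong (S zero +ᵛ_) (blockSum-∪ ω (S ∘ suc) p q
                                              λ e u v → disjoint (suc e) (there u) (there v)) ⟩
  S zero +ᵛ (P +ᵛ Q)                     ≡⟨ +ᵛ-assoc (S zero) P Q ⟨
  (S zero +ᵛ P) +ᵛ Q                     ≡⟨ cong ((S zero +ᵛ P) +ᵛ_) (+ᵛ-identityˡ Q) ⟨
  (S zero +ᵛ P) +ᵛ (0ᵛ +ᵛ Q)             ∎
  where
  open ≡-Reasoning
  P = blockSum ω (S ∘ suc) p
  Q = blockSum ω (S ∘ suc) q
blockSum-∪ ω S (outside ∷ p) (y ∷ q) disjoint = begin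
  v +ᵛ blockSum ω (S ∘ suc) (p ∪ q) ≡⟨ cong (v +ᵛ_) (blockSum-∪ ω (S ∘ suc) p q
                                         λ e u v → disjoint (suc e) (there u) (there v)) ⟩
  v +ᵛ (P +ᵛ Q)                     ≡⟨ cong (v +ᵛ_) (+ᵛ-comm P Q) ⟩
  v +ᵛ (Q +ᵛ P)                     ≡⟨ +ᵛ-assoc v Q P ⟨
  (v +ᵛ Q) +ᵛ P                     ≡⟨ +ᵛ-comm (v +ᵛ Q) P ⟩
  P +ᵛ (v +ᵛ Q)                     ≡⟨ cong (_+ᵛ (v +ᵛ Q)) (+ᵛ-identityˡ P) ⟨
  (0ᵛ +ᵛ P) +ᵛ (v +ᵛ Q)             ∎
  where
  open ≡-Reasoning
  v = if y then S zero else 0ᵛ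
  P = blockSum ω (S ∘ suc) p
  Q = blockSum ω (S ∘ suc) q

n≤free : ∀ {n} (p q : Subset n) → n ℕ.≤ free (p ∪ q) ℕ.+ (∣ p ∣ ℕ.+ ∣ q ∣)
n≤free [] [] = ℕ.z≤n
n≤free (outside ∷ p) (outside ∷ q) = ℕ.s≤s (n≤free p q)
n≤free (inside ∷ p) (outside ∷ q) =
  ℕₚ.≤-trans (ℕ.s≤s (n≤free p q)) (ℕₚ.≤-reflexive (sym (ℕₚ.+-suc _ _)))
n≤free (outside ∷ p) (inside ∷ q) = ℕₚ.≤-trans (ℕ.s≤s (n≤free p q)) (ℕₚ.≤-reflexive
  (sym (trans (cong (free (p ∪ q) ℕ.+_) (ℕₚ.+-suc ∣ p ∣ ∣ q ∣)) (ℕₚ.+-suc _ _))))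
n≤free (inside ∷ p) (inside ∷ q) = ℕₚ.≤-trans (ℕ.s≤s (n≤free p q)) (ℕₚ.≤-trans
  (ℕₚ.≤-reflexive (sym (ℕₚ.+-suc (free (p ∪ q)) (∣ p ∣ ℕ.+ ∣ q ∣))))
  (ℕₚ.+-monoʳ-≤ (free (p ∪ q)) (ℕ.s≤s (ℕₚ.+-monoʳ-≤ ∣ p ∣ (ℕₚ.n≤1+n ∣ q ∣)))))

module Blocks {r n : ℕ} (long : n ≡ 2 ℕ.* (4 ℕ.+ r) ℕ.+ 3)
  (ω : F₃^ (4 ℕ.+ r) → F₃^ (4 ℕ.+ r) → F₃)
  (isAlternating : IsAlternatingForm ω)
  (radical : ∀ x → InRadical ω x ⇔ InR x)
  (restriction : ∀ p q → ω (ιP p) (ιP q) ≡ ωP p q)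
  (S : Vector (F₃^ (4 ℕ.+ r)) n)
  (noFull : NoFull ω S)
  (nonzero : ∀ i → projP (S i) ≢ 0ᵛ) where

  open IsAlternatingForm isAlternating
  open Form ω isAlternating radical restriction

  W : Fin n → Fin n → F₃
  W i j = ω (S i) (S j)

  W-antisym : ∀ i j → W i j ≡ - W j i
  W-antisym i j = ω-antisym (S i) (S j)

  open Triangles W W-antisym

  -- Without the two indices 2a + 1 remain, exactly the bound of `δ-deg`. Adding 2 on both sides
  -- avoids truncated subtraction.
  N-pair : ∀ i j → N ω S (⁅ i ⁆ ∪ ⁅ j ⁆) ≡ 0#
  N-pair i j = N-vanishes ω S (⁅ i ⁆ ∪ ⁅ j ⁆) (ℕₚ.+-cancelʳ-≤ 2 _ _ (begin
    suc (2 ℕ.* (4 ℕ.+ r)) ℕ.+ 2                  ≡⟨ ℕₚ.+-suc (2 ℕ.* (4 ℕ.+ r)) 2 ⟨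
    2 ℕ.* (4 ℕ.+ r) ℕ.+ 3                        ≡⟨ long ⟨
    n                                            ≤⟨ n≤free ⁅ i ⁆ ⁅ j ⁆ ⟩
    free (⁅ i ⁆ ∪ ⁅ j ⁆) ℕ.+ (∣ ⁅ i ⁆ ∣ ℕ.+ ∣ ⁅ j ⁆ ∣)
      ≡⟨ cong₂ (λ x y → free (⁅ i ⁆ ∪ ⁅ j ⁆) ℕ.+ (x ℕ.+ y)) (∣⁅x⁆∣≡1 i) (∣⁅x⁆∣≡1 j) ⟩
    free (⁅ i ⁆ ∪ ⁅ j ⁆) ℕ.+ 2                   ∎))
    where open ℕₚ.≤-Reasoning

  Triangle : Subset n → Set
  Triangle B = OneBalancedTriangle ω S B

  triangle : ∀ {B p q} → VectorZero ω S B → p ∈ B → q ∈ B → W p q ≢ 0# → Triangle B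
  triangle {B} {p} {q} zero-sum p∈ q∈ pq≢0 = choose (noFull B zero-sum)
    where
    choose : Commuting ω S B ⊎ Triangle B → Triangle B
    choose (inj₁ commuting) = contradiction (p∈ , q∈ , pq≢0) (commuting p q)
    choose (inj₂ t)         = t

  -- All edges of `B` lie in one triple. The edges of `K` place i, j, k in it, so an edge at e would
  -- give it a fourth element.
  no-other-edge : ∀ {B i j k e f} → VectorZero ω S B → Balanced₃ i j k →
    i ∈ B → j ∈ B → k ∈ B → e ∈ B → f ∈ B → e ≢ i → e ≢ j → e ≢ k → W e f ≡ 0#
  no-other-edge {B} {i} {j} {k} {e} {f} zero-sum K i∈ j∈ k∈ e∈ f∈ e≢i e≢j e≢k =
    decidable-stable (W e f ≟ 0#) λ ef≢0 → from ef≢0 (triangle zero-sum e∈ f∈ ef≢0)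
    where
    module K = Balanced₃ K
    from : W e f ≢ 0# → Triangle B → ⊥
    from ef≢0 (_ , (a , b , c , refl , _) , edges) = no-fourth
      (proj₁ (Equivalence.to (edges e f) (e∈ , f∈ , ef≢0)))
      (proj₁ ij) (proj₁ (proj₂ ij)) (proj₁ ki)
      (proj₂ (proj₂ ij)) (proj₂ (proj₂ jk)) (proj₂ (proj₂ ki)) e≢i e≢j e≢k
      where
      ij = Equivalence.to (edges i j) (i∈ , j∈ , K.ij≢0)
      jk = Equivalence.to (edges j k) (j∈ , k∈ , λ p → K.ij≢0 (trans (sym K.jk) p))
      ki = Equivalence.to (edges k i) (k∈ , i∈ , K.ki≢0)

  -- A nonvanishing alternating sum has a nonvanishing term.
  block : ∀ {Y} → N ω S Y ≢ 0# → ∃[ B ] VectorZero ω S B × Y ⊆ B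
  block {Y} N≢0 = B , decidable-stable (vectorZero? ω S B) not-nonzero , ⟦⟧-≢0 (Y ⊆? B) t≢0
    where
    t : Subset n → F₃
    t B = ⟦ Y ⊆? B ⟧ * ((- 1#) ^ ∣ B ∣ * ⟦ vectorZero? ω S B ⟧)
    found : ∃[ B ] t B ≢ 0#
    found = ∑-≢0 (subsets n) t λ p → N≢0 (trans (N-expand ω S Y) p)
    B : Subset n
    B = proj₁ found
    t≢0 : t B ≢ 0#
    t≢0 = proj₂ found
    not-nonzero : ¬ ¬ VectorZero ω S B
    not-nonzero ¬zero = t≢0 (trans
      (cong (λ x → ⟦ Y ⊆? B ⟧ * ((- 1#) ^ ∣ B ∣ * x)) (⟦⟧-no (vectorZero? ω S B) ¬zero))
      (trans (cong (⟦ Y ⊆? B ⟧ *_) (*-zeroʳ ((- 1#) ^ ∣ B ∣))) (*-zeroʳ ⟦ Y ⊆? B ⟧)))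

  -- The block is computed from `N≢0` and not stored, so liveness amounts to two decidable
  -- conditions on the triple.
  record Live (i j k : Fin n) : Set where
    constructor live
    field
      shape : Balanced₃ i j k
      N≢0   : N ω S (triple i j k) ≢ 0#
    B : Subset n
    B = proj₁ (block N≢0)
    zero-sum : VectorZero ω S B
    zero-sum = proj₁ (proj₂ (block N≢0))
    K⊆B : triple i j k ⊆ B
    K⊆B = proj₂ (proj₂ (block N≢0))
    i∈B : i ∈ B
    i∈B = K⊆B (∈-triple⁺ (inj₁ refl))
    j∈B : j ∈ B
    j∈B = K⊆B (∈-triple⁺ (inj₂ (inj₁ refl)))
    k∈B : k ∈ B
    k∈B = K⊆B (∈-triple⁺ (inj₂ (inj₂ refl)))

  rotate : ∀ {i j k} → Live i j k → Live j k i
  rotate {i} {j} {k} (live K N≢0) =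
    live (rotate₃ K) (subst (λ Y → N ω S Y ≢ 0#) (sym (triple-rotate i j k)) N≢0)

  flip : ∀ {i j k} → Live i j k → Live i k j
  flip {i} {j} {k} (live K N≢0) =
    live (flip₃ K) (subst (λ Y → N ω S Y ≢ 0#) (sym (triple-flip i j k)) N≢0)

  C : ∀ {i j k} → Live i j k → Fin n → Set
  C {i} {j} {k} L e = e ∈ Live.B L × e ≢ i × e ≢ j × e ≢ k

  isolated-from : ∀ {i j k e f} (L : Live i j k) → C L e → f ∈ Live.B L → W e f ≡ 0#
  isolated-from L (e∈ , e≢i , e≢j , e≢k) f∈ = no-other-edge (Live.zero-sum L) (Live.shape L)
    (Live.i∈B L) (Live.j∈B L) (Live.k∈B L) e∈ f∈ e≢i e≢j e≢k

  isolated : ∀ {i j k e} (L : Live i j k) → C L e → W e i ≡ 0# × W e j ≡ 0# × W e k ≡ 0#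
  isolated L d = isolated-from L d (Live.i∈B L) , isolated-from L d (Live.j∈B L) ,
    isolated-from L d (Live.k∈B L)

  h : Fin n → Fin n → Fin n → F₃^ (4 ℕ.+ r)
  h i j k = S i +ᵛ S j +ᵛ S k

  ω-h : ∀ i j k v → ω (h i j k) v ≡ ω (S i) v + ω (S j) v + ω (S k) v
  ω-h i j k v = trans (+-linearˡ (S i +ᵛ S j) (S k) v) (cong (_+ ω (S k) v) (+-linearˡ (S i) (S j) v))

  ω-hʳ : ∀ v i j k → ω v (h i j k) ≡ ω v (S i) + ω v (S j) + ω v (S k)
  ω-hʳ v i j k = trans (+-linearʳ v (S i +ᵛ S j) (S k)) (cong (_+ ω v (S k)) (+-linearʳ v (S i) (S j)))

  private
    ⊥h : ∀ {i j k l} → H i j k l ≡ 0# → ω (S l) (h i j k) ≡ 0#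
    ⊥h {i} {j} {k} {l} p = trans (ω-antisym (S l) (h i j k))
      (cong (λ x → - x) (trans (ω-h i j k (S l)) p))

  -- Both e and h_K are orthogonal to the hyperbolic pair `S i`, `S j`, and e is orthogonal to h_K,
  -- being orthogonal to its three summands.
  proportional : ∀ {i j k e} → Live i j k → W e i ≡ 0# → W e j ≡ 0# → W e k ≡ 0# →
    ∃[ λ′ ] ∀ l → H i j k l ≡ λ′ * W e l
  proportional {i} {j} {k} {e} L ei ej ek = proj₁ multiple ,
    λ l → trans (sym (ω-h i j k (S l))) (proj₂ multiple (S l))
    where
    K = Live.shape L
    multiple = proportional-vectors (S i) (S j) (S e) (h i j k) (Balanced₃.ij≢0 K)
      (symm ei) (symm ej) (⊥h (proj₁ (H-self K))) (⊥h (proj₁ (proj₂ (H-self K))))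
      (trans (ω-hʳ (S e) i j k) (cong₂ _+_ (cong₂ _+_ ei ej) ek)) (nonzero e)

  parallel : ∀ {i j k e e′} (L : Live i j k) → C L e → C L e′ →
    ∃[ λ′ ] ∀ l → W e′ l ≡ λ′ * W e l
  parallel {i} {j} {k} {e} {e′} L d d′ = proj₁ multiple , λ l → proj₂ multiple (S l)
    where
    multiple = proportional-vectors (S i) (S j) (S e) (S e′) (Balanced₃.ij≢0 (Live.shape L))
      (symm (proj₁ (isolated L d))) (symm (proj₁ (proj₂ (isolated L d))))
      (symm (proj₁ (isolated L d′))) (symm (proj₁ (proj₂ (isolated L d′))))
      (isolated-from L d (proj₁ d′)) (nonzero e)

  -- The vectors `S k′` - `S k` and h_K are orthogonal to `S i` and `S j`, and to each other since
  -- h_K vanishes at k and has value `W k k′` at `k′`. As h_K is not zero as a functional, its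
  -- projection is nonzero and spans the line.
  difference : ∀ {i j k k′} → Live i j k → Live i j k′ → W k k′ ≡ 0# →
    ¬ (∀ l → H i j k l ≡ 0#) → ∃[ β ] ∀ l → W k′ l ≡ W k l + β * H i j k l
  difference {i} {j} {k} {k′} L L′ kk′ h≢0 = proj₁ multiple , λ l →
    solve (W k′ l) (W k l) (proj₁ multiple * H i j k l) (begin
      W k′ l + - 1# * W k l        ≡⟨ ω-d (S l) ⟨
      ω d (S l)                    ≡⟨ proj₂ multiple (S l) ⟩
      proj₁ multiple * ω (h i j k) (S l) ≡⟨ cong (proj₁ multiple *_) (ω-h i j k (S l)) ⟩
      proj₁ multiple * H i j k l   ∎)
    where
    open ≡-Reasoning
    module K = Balanced₃ (Live.shape L)
    module K′ = Balanced₃ (Live.shape L′)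
    d : F₃^ (4 ℕ.+ r)
    d = S k′ +ᵛ (- 1# · S k)
    ω-d : ∀ v → ω d v ≡ ω (S k′) v + - 1# * ω (S k) v
    ω-d v = trans (+-linearˡ (S k′) (- 1# · S k) v) (cong (ω (S k′) v +_) (·-linearˡ (- 1#) (S k) v))
    ω-dʳ : ∀ v → ω v d ≡ ω v (S k′) + - 1# * ω v (S k)
    ω-dʳ v = trans (+-linearʳ v (S k′) (- 1# · S k)) (cong (ω v (S k′) +_) (·-linearʳ (- 1#) v (S k)))
    subtract : ∀ x → x + - 1# * x ≡ 0#
    subtract = from-yes (all? λ x → x + - 1# * x ≟ 0#)
    solve : ∀ x y z → x + - 1# * y ≡ z → x ≡ y + z
    solve = from-yes (all? λ x → all? λ y → all? λ z →
      (x + - 1# * y ≟ z) →-dec (x ≟ y + z))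
    sum : ∀ c → (- c) + c + 0# ≡ 0#
    sum = from-yes (all? λ c → (- c) + c + 0# ≟ 0#)
    Hk′ : H i j k k′ ≡ 0#
    Hk′ = trans (H-cong {i} {j} {k} {k′} K′.ik K′.jk kk′) (sum (W i j))
    hd : ω (h i j k) d ≡ 0#
    hd = trans (ω-dʳ (h i j k)) (cong₂ (λ x y → x + - 1# * y)
      (trans (ω-h i j k (S k′)) Hk′)
      (trans (ω-h i j k (S k)) (proj₂ (proj₂ (H-self (Live.shape L))))))
    id : ω (S i) d ≡ 0#
    id = trans (ω-dʳ (S i)) (trans (cong (_+ - 1# * W i k) (trans K′.ik (sym K.ik))) (subtract (W i k)))
    jd : ω (S j) d ≡ 0#
    jd = trans (ω-dʳ (S j)) (trans (cong (_+ - 1# * W j k) (trans K′.jk (sym K.jk))) (subtract (W j k)))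
    projh≢0 : projP (h i j k) ≢ 0ᵛ
    projh≢0 p = h≢0 λ l → trans (sym (ω-h i j k (S l))) (projP-zero (h i j k) (S l) p)
    multiple = proportional-vectors (S i) (S j) (h i j k) d K.ij≢0
      (⊥h (proj₁ (H-self (Live.shape L)))) (⊥h (proj₁ (proj₂ (H-self (Live.shape L)))))
      id jd hd projh≢0

  member : ∀ {i j k e} (L : Live i j k) → e ∈ Live.B L → e ≡ i ⊎ e ≡ j ⊎ e ≡ k ⊎ C L e
  member {i} {j} {k} {e} L e∈ = classify (e ≟ i) (e ≟ j) (e ≟ k)
    where
    classify : Dec (e ≡ i) → Dec (e ≡ j) → Dec (e ≡ k) → e ≡ i ⊎ e ≡ j ⊎ e ≡ k ⊎ C L e
    classify (yes p) _       _       = inj₁ p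
    classify (no _)  (yes p) _       = inj₂ (inj₁ p)
    classify (no _)  (no _)  (yes p) = inj₂ (inj₂ (inj₁ p))
    classify (no p)  (no q)  (no r)  = inj₂ (inj₂ (inj₂ (e∈ , p , q , r)))

  -- The union of two disjoint vector-zero blocks is vector-zero, so they
  -- cannot both contain a triangle.
  meet : ∀ {i j k i′ j′ k′} (L : Live i j k) (L′ : Live i′ j′ k′) →
    ∃[ e ] (e ≡ i ⊎ e ≡ j ⊎ e ≡ k ⊎ C L e) × (e ≡ i′ ⊎ e ≡ j′ ⊎ e ≡ k′ ⊎ C L′ e)
  meet {i} {j} {k} {i′} {j′} {k′} L L′ =
    choose (any? λ e → (e ∈? Live.B L) ×-dec (e ∈? Live.B L′))
    where
    Common = ∃[ e ] e ∈ Live.B L × e ∈ Live.B L′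
    choose : Dec Common → _
    choose (yes (e , e∈ , e∈′)) = e , member L e∈ , member L′ e∈′
    choose (no ¬common) = contradiction
      (no-other-edge zero-sum (Live.shape L) (inˡ (Live.i∈B L)) (inˡ (Live.j∈B L)) (inˡ (Live.k∈B L))
        (inʳ (Live.i∈B L′)) (inʳ (Live.j∈B L′))
        (outside-L (Live.i∈B L)) (outside-L (Live.j∈B L)) (outside-L (Live.k∈B L)))
      (Balanced₃.ij≢0 (Live.shape L′))
      where
      inˡ : ∀ {e} → e ∈ Live.B L → e ∈ Live.B L ∪ Live.B L′
      inˡ e∈ = x∈p∪q⁺ (inj₁ e∈)
      inʳ : ∀ {e} → e ∈ Live.B L′ → e ∈ Live.B L ∪ Live.B L′
      inʳ e∈ = x∈p∪q⁺ {p = Live.B L} (inj₂ e∈)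
      outside-L : ∀ {e} → e ∈ Live.B L → i′ ≢ e
      outside-L e∈ refl = ¬common (i′ , e∈ , Live.i∈B L′)
      zero-sum : VectorZero ω S (Live.B L ∪ Live.B L′)
      zero-sum = trans (blockSum-∪ ω S (Live.B L) (Live.B L′) λ e e∈ e∈′ → ¬common (e , e∈ , e∈′))
        (trans (cong₂ _+ᵛ_ (Live.zero-sum L) (Live.zero-sum L′)) (+ᵛ-identityˡ 0ᵛ))

  -- The relation between the coefficients at an edge

  Through : Fin n → Fin n → Subset n → Set
  Through i j K = Balanced ω S K × i ∈ K × j ∈ K

  through? : ∀ i j K → Dec (Through i j K)
  through? i j K = balanced? ω S K ×-dec ((i ∈? K) ×-dec (j ∈? K))

  private
    weight : Subset n → F₃
    weight B = (- 1#) ^ ∣ B ∣ * ⟦ vectorZero? ω S B ⟧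

  -- A vector-zero block through the edge ij contains exactly one balanced
  -- triple through that edge.
  triples-in-block : ∀ {i j} → W i j ≢ 0# → ∀ B →
    ∑ (subsets n) (λ K → ⟦ through? i j K ⟧ * (⟦ K ⊆? B ⟧ * weight B)) ≡
    ⟦ ⁅ i ⁆ ∪ ⁅ j ⁆ ⊆? B ⟧ * weight B
  triples-in-block {i} {j} ij≢0 B = by (vectorZero? ω S B) (⁅ i ⁆ ∪ ⁅ j ⁆ ⊆? B)
    where
    open ≡-Reasoning
    Inside : Subset n → Set
    Inside K = Through i j K × K ⊆ B
    inside? : ∀ K → Dec (Inside K)
    inside? K = through? i j K ×-dec (K ⊆? B)
    regroup : ∀ K → ⟦ through? i j K ⟧ * (⟦ K ⊆? B ⟧ * weight B) ≡ ⟦ inside? K ⟧ * weight B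
    regroup K = trans (sym (*-assoc ⟦ through? i j K ⟧ ⟦ K ⊆? B ⟧ (weight B)))
      (cong (_* weight B) (sym (⟦⟧-× (through? i j K) (K ⊆? B))))
    i∈Y : i ∈ ⁅ i ⁆ ∪ ⁅ j ⁆
    i∈Y = x∈p∪q⁺ (inj₁ (x∈⁅x⁆ i))
    j∈Y : j ∈ ⁅ i ⁆ ∪ ⁅ j ⁆
    j∈Y = x∈p∪q⁺ {p = ⁅ i ⁆} (inj₂ (x∈⁅x⁆ j))
    Y⊆ : ∀ {K} → i ∈ K → j ∈ K → ⁅ i ⁆ ∪ ⁅ j ⁆ ⊆ K
    Y⊆ i∈ j∈ {e} e∈ = go (x∈p∪q⁻ ⁅ i ⁆ ⁅ j ⁆ e∈)
      where
      go : e ∈ ⁅ i ⁆ ⊎ e ∈ ⁅ j ⁆ → e ∈ _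
      go (inj₁ p) = subst (_∈ _) (sym (x∈⁅y⁆⇒x≡y i p)) i∈
      go (inj₂ p) = subst (_∈ _) (sym (x∈⁅y⁆⇒x≡y j p)) j∈

    -- The edges of a balanced triple inside the block are edges of `K₀`, so the triple lies in
    -- `K₀`; having three elements, it is `K₀`.
    unique : VectorZero ω S B → Triangle B → ⁅ i ⁆ ∪ ⁅ j ⁆ ⊆ B →
      ∃[ K₀ ] Inside K₀ × (∀ K → Inside K → K ≡ K₀)
    unique zero-sum (K₀ , bal₀@(a , b , c , refl , ab≡bc , bc≡ca , ca≢0) , edges) Y⊆B =
      K₀ , ((bal₀ , proj₁ ij , proj₁ (proj₂ ij)) , K₀⊆B) , only
      where
      ij = Equivalence.to (edges i j) (Y⊆B i∈Y , Y⊆B j∈Y , ij≢0)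
      module K₀ = Balanced₃ {a} {b} {c} (balanced ab≡bc bc≡ca ca≢0)
      a∈K₀ : a ∈ K₀
      a∈K₀ = ∈-triple⁺ (inj₁ refl)
      b∈K₀ : b ∈ K₀
      b∈K₀ = ∈-triple⁺ (inj₂ (inj₁ refl))
      c∈K₀ : c ∈ K₀
      c∈K₀ = ∈-triple⁺ (inj₂ (inj₂ refl))
      off-diagonal : ∀ {p q} → W p q ≢ 0# → p ≢ q
      off-diagonal {p} pq≢0 refl = pq≢0 (W-diag p)
      K₀⊆B : K₀ ⊆ B
      K₀⊆B = triple-⊆
        (proj₁ (Equivalence.from (edges a b) (a∈K₀ , b∈K₀ , off-diagonal K₀.ij≢0)))
        (proj₁ (proj₂ (Equivalence.from (edges a b) (a∈K₀ , b∈K₀ , off-diagonal K₀.ij≢0))))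
        (proj₁ (Equivalence.from (edges c a) (c∈K₀ , a∈K₀ , off-diagonal ca≢0)))
      only : ∀ K → Inside K → K ≡ K₀
      only K (((a′ , b′ , c′ , refl , p , q , r) , _) , K⊆B) = ⊆-antisym K⊆K₀ K₀⊆K
        where
        module K = Balanced₃ {a′} {b′} {c′} (balanced p q r)
        a′∈B : a′ ∈ B
        a′∈B = K⊆B (∈-triple⁺ (inj₁ refl))
        b′∈B : b′ ∈ B
        b′∈B = K⊆B (∈-triple⁺ (inj₂ (inj₁ refl)))
        c′∈B : c′ ∈ B
        c′∈B = K⊆B (∈-triple⁺ (inj₂ (inj₂ refl)))
        a′b′ = Equivalence.to (edges a′ b′) (a′∈B , b′∈B , K.ij≢0)
        c′a′ = Equivalence.to (edges c′ a′) (c′∈B , a′∈B , r)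
        b′≢c′ : b′ ≢ c′
        b′≢c′ = off-diagonal λ s → K.ij≢0 (trans (sym K.jk) s)
        K⊆K₀ : K ⊆ K₀
        K⊆K₀ = triple-⊆ (proj₁ a′b′) (proj₁ (proj₂ a′b′)) (proj₁ c′a′)
        K₀⊆K : K₀ ⊆ K
        K₀⊆K {e} e∈ = decidable-stable (e ∈? K) λ e∉ → no-fourth
          e∈ (proj₁ a′b′) (proj₁ (proj₂ a′b′)) (proj₁ c′a′)
          (proj₂ (proj₂ a′b′)) b′≢c′ (proj₂ (proj₂ c′a′))
          (λ s → e∉ (∈-triple⁺ (inj₁ s))) (λ s → e∉ (∈-triple⁺ (inj₂ (inj₁ s))))
          (λ s → e∉ (∈-triple⁺ (inj₂ (inj₂ s))))

    Goal : Set
    Goal = ∑ (subsets n) (λ K → ⟦ through? i j K ⟧ * (⟦ K ⊆? B ⟧ * weight B)) ≡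
      ⟦ ⁅ i ⁆ ∪ ⁅ j ⁆ ⊆? B ⟧ * weight B

    by : Dec (VectorZero ω S B) → Dec (⁅ i ⁆ ∪ ⁅ j ⁆ ⊆ B) → Goal
    by (no ¬zero) _ = begin
      ∑ (subsets n) (λ K → ⟦ through? i j K ⟧ * (⟦ K ⊆? B ⟧ * weight B))
        ≡⟨ ∑-zero (subsets n) (λ K → trans (cong (λ x → ⟦ through? i j K ⟧ * (⟦ K ⊆? B ⟧ * x)) weight≡0)
             (trans (cong (⟦ through? i j K ⟧ *_) (*-zeroʳ ⟦ K ⊆? B ⟧)) (*-zeroʳ ⟦ through? i j K ⟧))) ⟩
      0#
        ≡⟨ trans (cong (⟦ ⁅ i ⁆ ∪ ⁅ j ⁆ ⊆? B ⟧ *_) weight≡0) (*-zeroʳ ⟦ ⁅ i ⁆ ∪ ⁅ j ⁆ ⊆? B ⟧) ⟨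
      ⟦ ⁅ i ⁆ ∪ ⁅ j ⁆ ⊆? B ⟧ * weight B ∎
      where
      weight≡0 : weight B ≡ 0#
      weight≡0 = trans (cong ((- 1#) ^ ∣ B ∣ *_) (⟦⟧-no (vectorZero? ω S B) ¬zero))
        (*-zeroʳ ((- 1#) ^ ∣ B ∣))
    by (yes _) (no Y⊈B) = begin
      ∑ (subsets n) (λ K → ⟦ through? i j K ⟧ * (⟦ K ⊆? B ⟧ * weight B))
        ≡⟨ ∑-zero (subsets n) (λ K → trans (regroup K) (trans (cong (_* weight B)
             (⟦⟧-no (inside? K) λ ((_ , i∈ , j∈) , K⊆B) → Y⊈B (Y⊆ (K⊆B i∈) (K⊆B j∈))))
             (*-zeroˡ (weight B)))) ⟩
      0#
        ≡⟨ trans (cong (_* weight B) (⟦⟧-no (⁅ i ⁆ ∪ ⁅ j ⁆ ⊆? B) Y⊈B)) (*-zeroˡ (weight B)) ⟨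
      ⟦ ⁅ i ⁆ ∪ ⁅ j ⁆ ⊆? B ⟧ * weight B ∎
    by (yes zero-sum) (yes Y⊆B) = begin
      ∑ (subsets n) (λ K → ⟦ through? i j K ⟧ * (⟦ K ⊆? B ⟧ * weight B))
        ≡⟨ ∑-cong (subsets n) regroup ⟩
      ∑ (subsets n) (λ K → ⟦ inside? K ⟧ * weight B)
        ≡⟨ ∑-unique-subset inside? (λ _ → weight B) (proj₁ (proj₂ K₀)) (proj₂ (proj₂ K₀)) ⟩
      weight B
        ≡⟨ trans (cong (_* weight B) (⟦⟧-yes (⁅ i ⁆ ∪ ⁅ j ⁆ ⊆? B) Y⊆B)) (*-identityˡ (weight B)) ⟨
      ⟦ ⁅ i ⁆ ∪ ⁅ j ⁆ ⊆? B ⟧ * weight B ∎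
      where
      K₀ = unique zero-sum (triangle zero-sum (Y⊆B i∈Y) (Y⊆B j∈Y) ij≢0) Y⊆B

  -- Double counting: after exchanging the sums, each vector-zero block through the edge is counted
  -- once, and the total is `N` of the pair.
  edge-sum : ∀ {i j} → W i j ≢ 0# → ∑ (subsets n) (λ K → ⟦ through? i j K ⟧ * N ω S K) ≡ 0#
  edge-sum {i} {j} ij≢0 = begin
    ∑ (subsets n) (λ K → ⟦ through? i j K ⟧ * N ω S K)
      ≡⟨ ∑-cong (subsets n) (λ K → trans (cong (⟦ through? i j K ⟧ *_) (N-expand ω S K))
           (sym (∑-*ˡ (subsets n) ⟦ through? i j K ⟧ (λ B → ⟦ K ⊆? B ⟧ * weight B)))) ⟩
    ∑ (subsets n) (λ K → ∑ (subsets n) (λ B → ⟦ through? i j K ⟧ * (⟦ K ⊆? B ⟧ * weight B)))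
      ≡⟨ ∑-swap (subsets n) (subsets n) (λ K B → ⟦ through? i j K ⟧ * (⟦ K ⊆? B ⟧ * weight B)) ⟩
    ∑ (subsets n) (λ B → ∑ (subsets n) (λ K → ⟦ through? i j K ⟧ * (⟦ K ⊆? B ⟧ * weight B)))
      ≡⟨ ∑-cong (subsets n) (triples-in-block ij≢0) ⟩
    ∑ (subsets n) (λ B → ⟦ ⁅ i ⁆ ∪ ⁅ j ⁆ ⊆? B ⟧ * weight B)
      ≡⟨ N-expand ω S (⁅ i ⁆ ∪ ⁅ j ⁆) ⟨
    N ω S (⁅ i ⁆ ∪ ⁅ j ⁆)
      ≡⟨ N-pair i j ⟩
    0# ∎
    where open ≡-Reasoning

  third : ∀ {i j K} → Through i j K → i ≢ j → ∃[ k ] Balanced₃ i j k × triple i j k ≡ K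
  third {i} {j} {K} ((a , b , c , refl , p , q , r) , i∈ , j∈) i≢j =
    find (∈-triple⁻ i∈) (∈-triple⁻ j∈)
    where
    L : Balanced₃ a b c
    L = balanced p q r
    find : OneOf a b c i → OneOf a b c j → ∃[ k ] Balanced₃ i j k × triple i j k ≡ triple a b c
    find (inj₁ refl)        (inj₁ refl)        = contradiction refl i≢j
    find (inj₁ refl)        (inj₂ (inj₁ refl)) = c , L , refl
    find (inj₁ refl)        (inj₂ (inj₂ refl)) = b , flip₃ L , triple-flip a b c
    find (inj₂ (inj₁ refl)) (inj₁ refl)        = c , flip₃ (rotate₃ L) ,
      trans (triple-flip b c a) (triple-rotate a b c)
    find (inj₂ (inj₁ refl)) (inj₂ (inj₁ refl)) = contradiction refl i≢j
    find (inj₂ (inj₁ refl)) (inj₂ (inj₂ refl)) = a , rotate₃ L , triple-rotate a b c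
    find (inj₂ (inj₂ refl)) (inj₁ refl)        = b , rotate₃ (rotate₃ L) ,
      trans (triple-rotate b c a) (triple-rotate a b c)
    find (inj₂ (inj₂ refl)) (inj₂ (inj₁ refl)) = a , flip₃ (rotate₃ (rotate₃ L)) ,
      trans (triple-flip c a b) (trans (triple-rotate b c a) (triple-rotate a b c))
    find (inj₂ (inj₂ refl)) (inj₂ (inj₂ refl)) = contradiction refl i≢j

  toBalanced : ∀ {i j k} → Balanced₃ i j k → Balanced ω S (triple i j k)
  toBalanced {i} {j} {k} K = i , j , k , refl , Balanced₃.ij≡jk K , Balanced₃.jk≡ki K , Balanced₃.ki≢0 K

  -- Were `K₀` the only live triangle at the edge, the vanishing edge sum would reduce to its single
  -- nonzero term.
  another : ∀ {i j k} → Live i j k → ∃[ k′ ] k′ ≢ k × Live i j k′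
  another {i} {j} {k} L = choose (anySubset? λ K → ¬? (K ≟ˢ K₀) ×-dec
      (through? i j K ×-dec ¬? (N ω S K ≟ 0#)))
    where
    K₀ = triple i j k
    i≢j : i ≢ j
    i≢j refl = Balanced₃.ij≢0 (Live.shape L) (W-diag i)
    K₀-through : Through i j K₀
    K₀-through = toBalanced (Live.shape L) , ∈-triple⁺ (inj₁ refl) , ∈-triple⁺ (inj₂ (inj₁ refl))
    Other : Subset n → Set
    Other K = K ≢ K₀ × Through i j K × N ω S K ≢ 0#
    choose : Dec (∃[ K ] Other K) → ∃[ k′ ] k′ ≢ k × Live i j k′
    choose (yes (K , K≢K₀ , t , N≢0)) = from (third t i≢j)
      where
      from : ∃[ k′ ] Balanced₃ i j k′ × triple i j k′ ≡ K → ∃[ k′ ] k′ ≢ k × Live i j k′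
      from (k′ , K′ , eq) = k′ , (λ p → K≢K₀ (trans (sym eq) (cong (triple i j) p))) ,
        live K′ (subst (λ Y → N ω S Y ≢ 0#) (sym eq) N≢0)
    choose (no ¬other) = contradiction (trans (sym sum) (edge-sum (Balanced₃.ij≢0 (Live.shape L)))) (Live.N≢0 L)
      where
      only : ∀ K → ⟦ through? i j K ⟧ * N ω S K ≡ ⟦ K ≟ˢ K₀ ⟧ * N ω S K
      only K = pick (K ≟ˢ K₀) (N ω S K ≟ 0#)
        where
        pick : Dec (K ≡ K₀) → Dec (N ω S K ≡ 0#) →
          ⟦ through? i j K ⟧ * N ω S K ≡ ⟦ K ≟ˢ K₀ ⟧ * N ω S K
        pick (yes p) _ = cong (_* N ω S K)
          (trans (⟦⟧-yes (through? i j K) (subst (Through i j) (sym p) K₀-through))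
            (sym (⟦⟧-yes (K ≟ˢ K₀) p)))
        pick (no _) (yes N≡0) = trans (trans (cong (⟦ through? i j K ⟧ *_) N≡0) (*-zeroʳ ⟦ through? i j K ⟧))
          (sym (trans (cong (⟦ K ≟ˢ K₀ ⟧ *_) N≡0) (*-zeroʳ ⟦ K ≟ˢ K₀ ⟧)))
        pick (no K≢K₀) (no N≢0) = cong (_* N ω S K)
          (trans (⟦⟧-no (through? i j K) λ t → ¬other (K , K≢K₀ , t , N≢0))
            (sym (⟦⟧-no (K ≟ˢ K₀) K≢K₀)))
      sum : ∑ (subsets n) (λ K → ⟦ through? i j K ⟧ * N ω S K) ≡ N ω S K₀
      sum = trans (∑-cong (subsets n) only) (∑-subset K₀ (N ω S))

  open LiveTriangles Live Live.shape rotate flip another C isolated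
    proportional parallel difference meet using (coherent)

  -- Marking one edge of every live triangle

  balanced₃? : ∀ i j k → Dec (Balanced₃ i j k)
  balanced₃? i j k = map′ (λ (p , q , r) → balanced p q r)
    (λ K → Balanced₃.ij≡jk K , Balanced₃.jk≡ki K , Balanced₃.ki≢0 K)
    ((W i j ≟ W j k) ×-dec ((W j k ≟ W k i) ×-dec ¬? (W k i ≟ 0#)))

  live? : ∀ i j k → Dec (Live i j k)
  live? i j k = map′ (λ (K , N≢0) → live K N≢0) (λ L → Live.shape L , Live.N≢0 L)
    (balanced₃? i j k ×-dec ¬? (N ω S (triple i j k) ≟ 0#))

  -- The functional W e takes three different values on every live triangle
  -- through the edge pq, whichever that triangle is.
  record Separates (p q e : Fin n) : Set where
    constructor separates
    field
      admissible : ∀ a b c → Live a b c → H a b c p ≡ 0# → H a b c q ≡ 0# → H a b c e ≡ 0#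
      distinct   : W e p ≢ W e q

  separates? : ∀ p q e → Dec (Separates p q e)
  separates? p q e = map′ (λ (x , y) → separates x y)
    (λ s → Separates.admissible s , Separates.distinct s)
    ((all? λ a → all? λ b → all? λ c → live? a b c →-dec ((H a b c p ≟ 0#) →-dec
      ((H a b c q ≟ 0#) →-dec (H a b c e ≟ 0#)))) ×-dec ¬? (W e p ≟ W e q))

  -- The counterpart of `Separates` in terms of the vertex set alone, through which the edges of a
  -- triangle are compared.
  record SeparatesAll (K : Subset n) (e : Fin n) : Set where
    constructor separatesAll
    field
      admissible : ∀ a b c → Live a b c → (∀ x → x ∈ K → H a b c x ≡ 0#) → H a b c e ≡ 0#
      distinct   : ∀ x y → x ∈ K → y ∈ K → x ≢ y → W e x ≢ W e y

  module LiveEdge {i j k} (L : Live i j k) where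

    private
      K : Subset n
      K = triple i j k
      third-value : ∀ x y z → x + y + z ≡ 0# → x ≡ 0# → y ≡ 0# → z ≡ 0#
      third-value = from-yes (all? λ x → all? λ y → all? λ z →
        (x + y + z ≟ 0#) →-dec ((x ≟ 0#) →-dec ((y ≟ 0#) →-dec (z ≟ 0#))))
      spread : ∀ x y z → - (x + y + z) ≡ 0# → x ≢ y → y ≢ z × z ≢ x
      spread = from-yes (all? λ x → all? λ y → all? λ z →
        (- (x + y + z) ≟ 0#) →-dec (¬? (x ≟ y) →-dec (¬? (y ≟ z) ×-dec ¬? (z ≟ x))))

    i≢j : i ≢ j
    i≢j refl = Balanced₃.ij≢0 (Live.shape L) (W-diag i)

    -- Admissibility applies to the triangle itself, so the three values of `W e` sum to zero; two
    -- different ones then force three.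
    toAll : ∀ e → Separates i j e → SeparatesAll K e
    toAll e (separates admissible ij) = separatesAll
      (λ a b c L′ ⊥K → admissible a b c L′ (⊥K i (∈-triple⁺ (inj₁ refl))) (⊥K j (∈-triple⁺ (inj₂ (inj₁ refl)))))
      λ x y x∈ y∈ → compare (∈-triple⁻ x∈) (∈-triple⁻ y∈)
      where
      He : H i j k e ≡ 0#
      He = admissible i j k L (proj₁ (H-self (Live.shape L))) (proj₁ (proj₂ (H-self (Live.shape L))))
      others : W e j ≢ W e k × W e k ≢ W e i
      others = spread (W e i) (W e j) (W e k)
        (trans (cong (λ x → - x) (W-sum e i j k)) (trans (-‿involutive (H i j k e)) He)) ij
      compare : ∀ {x y} → OneOf i j k x → OneOf i j k y → x ≢ y → W e x ≢ W e y
      compare (inj₁ refl)        (inj₁ refl)        ne = contradiction refl ne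
      compare (inj₁ refl)        (inj₂ (inj₁ refl)) _ = ij
      compare (inj₁ refl)        (inj₂ (inj₂ refl)) _ = λ p → proj₂ others (sym p)
      compare (inj₂ (inj₁ refl)) (inj₁ refl)        _ = λ p → ij (sym p)
      compare (inj₂ (inj₁ refl)) (inj₂ (inj₁ refl)) ne = contradiction refl ne
      compare (inj₂ (inj₁ refl)) (inj₂ (inj₂ refl)) _ = proj₁ others
      compare (inj₂ (inj₂ refl)) (inj₁ refl)        _ = proj₂ others
      compare (inj₂ (inj₂ refl)) (inj₂ (inj₁ refl)) _ = λ p → proj₁ others (sym p)
      compare (inj₂ (inj₂ refl)) (inj₂ (inj₂ refl)) ne = contradiction refl ne

    -- Coherence enters here: a vertex sum orthogonal to i and j is orthogonal to k, so the edge
    -- imposes the same condition as the triangle.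
    fromAll : ∀ e → SeparatesAll K e → Separates i j e
    fromAll e (separatesAll admissible distinct) = separates
      (λ a b c L′ Hi Hj → admissible a b c L′ λ x x∈ → on a b c L′ Hi Hj (∈-triple⁻ x∈))
      (distinct i j (∈-triple⁺ (inj₁ refl)) (∈-triple⁺ (inj₂ (inj₁ refl))) i≢j)
      where
      on : ∀ a b c → Live a b c → H a b c i ≡ 0# → H a b c j ≡ 0# →
        ∀ {x} → OneOf i j k x → H a b c x ≡ 0#
      on a b c L′ Hi Hj (inj₁ refl)        = Hi
      on a b c L′ Hi Hj (inj₂ (inj₁ refl)) = Hj
      on a b c L′ Hi Hj (inj₂ (inj₂ refl)) =
        third-value (H a b c i) (H a b c j) (H a b c k) (coherent L′ L) Hi Hj

    -- Ensures that the search for a separating index succeeds on every live edge.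
    self : Separates i j i
    self = separates (λ _ _ _ _ Hi _ → Hi)
      (λ p → Balanced₃.ij≢0 (Live.shape L) (trans (sym p) (W-diag i)))

  -- Two distinct values in a fixed order single out one ordered pair of vertices; 0 and 1 are an
  -- arbitrary choice.
  Marked : Fin n → Fin n → Maybe (Fin n) → Set
  Marked p q nothing  = ⊥
  Marked p q (just e) = W e p ≡ 0# × W e q ≡ 1#

  marked? : ∀ p q e → Dec (Marked p q e)
  marked? p q nothing  = no λ ()
  marked? p q (just e) = (W e p ≟ 0#) ×-dec (W e q ≟ 1#)

  Chosen : Fin n → Fin n → Set
  Chosen p q = Marked p q (first (separates? p q))

  chosen? : ∀ p q → Dec (Chosen p q)
  chosen? p q = marked? p q (first (separates? p q))

  marked-≢ : ∀ {p q} e → Marked p q e → p ≢ q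
  marked-≢ (just e) (x , y) refl = contradiction (trans (sym x) y) λ()

  -- The same e serves all ordered edges of the triangle, and `W e` maps the vertices bijectively
  -- onto `F₃`, so 0 and 1 are each attained once.
  chosen-edge : ∀ {i j k} → Live i j k → ∃[ p₀ ] ∃[ q₀ ]
    (Chosen p₀ q₀ × Through p₀ q₀ (triple i j k)) ×
    (∀ p q → Chosen p q → Through p q (triple i j k) → p ≡ p₀ × q ≡ q₀)
  chosen-edge {i} {j} {k} L = p₀ , q₀ ,
    (subst (Marked p₀ q₀) (sym (first-edge p₀q₀ p₀≢q₀)) (proj₂ (proj₂ at-0) , proj₂ (proj₂ at-1)) , p₀q₀) ,
    λ p q chosen t → unique chosen t (marked-≢ (first (separates? p q)) chosen)
    where
    K : Subset n
    K = triple i j k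
    found : ∃[ e ] first (separates? i j) ≡ just e × Separates i j e
    found = first-exists (separates? i j) (LiveEdge.self L)
    e : Fin n
    e = proj₁ found
    all : SeparatesAll K e
    all = LiveEdge.toAll L e (proj₂ (proj₂ found))

    first-edge : ∀ {p q} → Through p q K → p ≢ q → first (separates? p q) ≡ just e
    first-edge {p} {q} t p≢q = from (third t p≢q)
      where
      from : ∃[ l ] Balanced₃ p q l × triple p q l ≡ K → first (separates? p q) ≡ just e
      from (l , M , eq) = trans (first-cong (separates? p q) (separates? i j)
        (λ x s → LiveEdge.fromAll L x (subst (λ Y → SeparatesAll Y x) eq (LiveEdge.toAll L′ x s)))
        (λ x s → LiveEdge.fromAll L′ x (subst (λ Y → SeparatesAll Y x) (sym eq) (LiveEdge.toAll L x s))))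
        (proj₁ (proj₂ found))
        where
        L′ : Live p q l
        L′ = live M (subst (λ Y → N ω S Y ≢ 0#) (sym eq) (Live.N≢0 L))

    i∈K : i ∈ K
    i∈K = ∈-triple⁺ (inj₁ refl)
    j∈K : j ∈ K
    j∈K = ∈-triple⁺ (inj₂ (inj₁ refl))
    k∈K : k ∈ K
    k∈K = ∈-triple⁺ (inj₂ (inj₂ refl))
    j≢k : j ≢ k
    j≢k = LiveEdge.i≢j (rotate L)
    k≢i : k ≢ i
    k≢i = LiveEdge.i≢j (rotate (rotate L))

    exhaust : ∀ (v x y z : F₃) → x ≢ y → y ≢ z → z ≢ x → x ≡ v ⊎ y ≡ v ⊎ z ≡ v
    exhaust = from-yes (all? λ (v : F₃) → all? λ (x : F₃) → all? λ y → all? λ z →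
      ¬? (x ≟ y) →-dec (¬? (y ≟ z) →-dec (¬? (z ≟ x) →-dec
      ((x ≟ v) ⊎-dec ((y ≟ v) ⊎-dec (z ≟ v))))))

    attain : ∀ v → ∃[ x ] x ∈ K × W e x ≡ v
    attain v = pick (exhaust v (W e i) (W e j) (W e k)
      (SeparatesAll.distinct all i j i∈K j∈K (LiveEdge.i≢j L))
      (SeparatesAll.distinct all j k j∈K k∈K j≢k)
      (SeparatesAll.distinct all k i k∈K i∈K k≢i))
      where
      pick : W e i ≡ v ⊎ W e j ≡ v ⊎ W e k ≡ v → ∃[ x ] x ∈ K × W e x ≡ v
      pick (inj₁ p)        = i , i∈K , p
      pick (inj₂ (inj₁ p)) = j , j∈K , p
      pick (inj₂ (inj₂ p)) = k , k∈K , p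

    injective : ∀ {x y} → x ∈ K → y ∈ K → W e x ≡ W e y → x ≡ y
    injective {x} {y} x∈ y∈ eq = decidable-stable (x ≟ y) λ x≢y →
      SeparatesAll.distinct all x y x∈ y∈ x≢y eq

    at-0 = attain 0#
    at-1 = attain 1#
    p₀ q₀ : Fin n
    p₀ = proj₁ at-0
    q₀ = proj₁ at-1
    p₀≢q₀ : p₀ ≢ q₀
    p₀≢q₀ eq = contradiction
      (trans (sym (proj₂ (proj₂ at-0))) (trans (cong (W e) eq) (proj₂ (proj₂ at-1)))) λ()
    p₀q₀ : Through p₀ q₀ K
    p₀q₀ = toBalanced (Live.shape L) , proj₁ (proj₂ at-0) , proj₁ (proj₂ at-1)

    unique : ∀ {p q} → Chosen p q → Through p q K → p ≢ q → p ≡ p₀ × q ≡ q₀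
    unique {p} {q} chosen t@(_ , p∈ , q∈) p≢q =
      injective p∈ (proj₁ (proj₂ at-0)) (trans (proj₁ values) (sym (proj₂ (proj₂ at-0)))) ,
      injective q∈ (proj₁ (proj₂ at-1)) (trans (proj₂ values) (sym (proj₂ (proj₂ at-1))))
      where
      values : W e p ≡ 0# × W e q ≡ 1#
      values = subst (Marked p q) (first-edge t p≢q) chosen

  -- Summation over the marked edges

  private
    entry : Fin n → Fin n → Subset n → F₃
    entry p q K = ⟦ chosen? p q ⟧ * (⟦ through? p q K ⟧ * N ω S K)

  chosen-edge′ : ∀ {K} → Balanced ω S K → N ω S K ≢ 0# → ∃[ p₀ ] ∃[ q₀ ]
    (Chosen p₀ q₀ × Through p₀ q₀ K) × (∀ p q → Chosen p q → Through p q K → p ≡ p₀ × q ≡ q₀)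
  chosen-edge′ (a , b , c , refl , x , y , z) N≢0 = chosen-edge (live (balanced x y z) N≢0)

  private
    indicator : ∀ {K p₀ q₀} → Chosen p₀ q₀ × Through p₀ q₀ K →
      (∀ p q → Chosen p q → Through p q K → p ≡ p₀ × q ≡ q₀) → ∀ x p q →
      ⟦ p ≟ p₀ ⟧ * (⟦ q ≟ q₀ ⟧ * x) ≡ ⟦ chosen? p q ⟧ * (⟦ through? p q K ⟧ * x)
    indicator {K} {p₀} {q₀} good unique x p q = begin
      ⟦ p ≟ p₀ ⟧ * (⟦ q ≟ q₀ ⟧ * x) ≡⟨ *-assoc ⟦ p ≟ p₀ ⟧ ⟦ q ≟ q₀ ⟧ x ⟨
      (⟦ p ≟ p₀ ⟧ * ⟦ q ≟ q₀ ⟧) * x ≡⟨ cong (_* x) product ⟩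
      (⟦ chosen? p q ⟧ * ⟦ through? p q K ⟧) * x ≡⟨ *-assoc ⟦ chosen? p q ⟧ ⟦ through? p q K ⟧ x ⟩
      ⟦ chosen? p q ⟧ * (⟦ through? p q K ⟧ * x) ∎
      where
      open ≡-Reasoning
      equivalent : ⟦ (p ≟ p₀) ×-dec (q ≟ q₀) ⟧ ≡ ⟦ chosen? p q ×-dec through? p q K ⟧
      equivalent = ⟦⟧-⇔ ((p ≟ p₀) ×-dec (q ≟ q₀)) (chosen? p q ×-dec through? p q K)
        (λ {(refl , refl) → good}) (λ (u , v) → unique p q u v)
      product : ⟦ p ≟ p₀ ⟧ * ⟦ q ≟ q₀ ⟧ ≡ ⟦ chosen? p q ⟧ * ⟦ through? p q K ⟧
      product = trans (sym (⟦⟧-× (p ≟ p₀) (q ≟ q₀)))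
        (trans equivalent (⟦⟧-× (chosen? p q) (through? p q K)))

    ∑∑-indicator : ∀ p₀ q₀ x →
      ∑ (allFin n) (λ p → ∑ (allFin n) (λ q → ⟦ p ≟ p₀ ⟧ * (⟦ q ≟ q₀ ⟧ * x))) ≡ x
    ∑∑-indicator p₀ q₀ x = trans
      (∑-cong (allFin n) λ p → trans (∑-*ˡ (allFin n) ⟦ p ≟ p₀ ⟧ (λ q → ⟦ q ≟ q₀ ⟧ * x))
        (cong (⟦ p ≟ p₀ ⟧ *_) (∑-fin q₀ (λ _ → x))))
      (∑-fin p₀ (λ _ → x))

  -- A live triple is counted by its one chosen pair; for every other `K` both sides are zero.
  balanced-by-edges : ∀ K → ⟦ balanced? ω S K ⟧ * N ω S K ≡
    ∑ (allFin n) (λ p → ∑ (allFin n) (λ q → entry p q K))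
  balanced-by-edges K = by (balanced? ω S K) (N ω S K ≟ 0#)
    where
    vanish : (∀ p q → ⟦ through? p q K ⟧ * N ω S K ≡ 0#) →
      ∑ (allFin n) (λ p → ∑ (allFin n) (λ q → entry p q K)) ≡ 0#
    vanish t≡0 = ∑-zero (allFin n) λ p → ∑-zero (allFin n) λ q →
      trans (cong (⟦ chosen? p q ⟧ *_) (t≡0 p q)) (*-zeroʳ ⟦ chosen? p q ⟧)

    by : Dec (Balanced ω S K) → Dec (N ω S K ≡ 0#) → ⟦ balanced? ω S K ⟧ * N ω S K ≡
      ∑ (allFin n) (λ p → ∑ (allFin n) (λ q → entry p q K))
    by (no ¬bal) _ = trans
      (trans (cong (_* N ω S K) (⟦⟧-no (balanced? ω S K) ¬bal)) (*-zeroˡ (N ω S K)))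
      (sym (vanish λ p q → trans (cong (_* N ω S K) (⟦⟧-no (through? p q K) λ t → ¬bal (proj₁ t)))
        (*-zeroˡ (N ω S K))))
    by (yes _) (yes N≡0) = trans
      (trans (cong (⟦ balanced? ω S K ⟧ *_) N≡0) (*-zeroʳ ⟦ balanced? ω S K ⟧))
      (sym (vanish λ p q → trans (cong (⟦ through? p q K ⟧ *_) N≡0) (*-zeroʳ ⟦ through? p q K ⟧)))
    by (yes bal) (no N≢0) = from (chosen-edge′ bal N≢0)
      where
      from : ∃[ p₀ ] ∃[ q₀ ] (Chosen p₀ q₀ × Through p₀ q₀ K) ×
          (∀ p q → Chosen p q → Through p q K → p ≡ p₀ × q ≡ q₀) →
        ⟦ balanced? ω S K ⟧ * N ω S K ≡ ∑ (allFin n) (λ p → ∑ (allFin n) (λ q → entry p q K))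
      from (p₀ , q₀ , good , unique) = trans
        (trans (cong (_* N ω S K) (⟦⟧-yes (balanced? ω S K) bal)) (*-identityˡ (N ω S K)))
        (trans (sym (∑∑-indicator p₀ q₀ (N ω S K)))
          (∑-cong (allFin n) λ p → ∑-cong (allFin n) λ q →
            indicator {K} {p₀} {q₀} good unique (N ω S K) p q))

  chosen-sum : ∀ p q → ∑ (subsets n) (entry p q) ≡ 0#
  chosen-sum p q = trans (∑-*ˡ (subsets n) ⟦ chosen? p q ⟧ (λ K → ⟦ through? p q K ⟧ * N ω S K))
    (by (chosen? p q) (W p q ≟ 0#))
    where
    total = ∑ (subsets n) (λ K → ⟦ through? p q K ⟧ * N ω S K)
    by : Dec (Chosen p q) → Dec (W p q ≡ 0#) → ⟦ chosen? p q ⟧ * total ≡ 0#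
    by (no ¬chosen) _ = trans (cong (_* total) (⟦⟧-no (chosen? p q) ¬chosen)) (*-zeroˡ total)
    by (yes _) (no pq≢0) =
      trans (cong (⟦ chosen? p q ⟧ *_) (edge-sum pq≢0)) (*-zeroʳ ⟦ chosen? p q ⟧)
    -- `Chosen` makes sense for orthogonal pairs too, but no balanced triple passes through such a
    -- pair.
    by (yes chosen) (yes pq≡0) = trans (cong (⟦ chosen? p q ⟧ *_)
      (∑-zero (subsets n) λ K → trans (cong (_* N ω S K) (⟦⟧-no (through? p q K) none)) (*-zeroˡ (N ω S K))))
      (*-zeroʳ ⟦ chosen? p q ⟧)
      where
      none : ∀ {K} → ¬ Through p q K
      none t = Balanced₃.ij≢0 (proj₁ (proj₂ (third t (marked-≢ (first (separates? p q)) chosen)))) pq≡0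

  Θ-vanishes : Θ ω S ≡ 0#
  Θ-vanishes = begin
    Θ ω S
      ≡⟨ ∑-filter (balanced? ω S) (subsets n) (μ ω S) ⟩
    ∑ (subsets n) (λ K → ⟦ balanced? ω S K ⟧ * (- N ω S K))
      ≡⟨ ∑-cong (subsets n) (λ K → negate ⟦ balanced? ω S K ⟧ (N ω S K)) ⟩
    ∑ (subsets n) (λ K → - 1# * (⟦ balanced? ω S K ⟧ * N ω S K))
      ≡⟨ ∑-*ˡ (subsets n) (- 1#) (λ K → ⟦ balanced? ω S K ⟧ * N ω S K) ⟩
    - 1# * ∑ (subsets n) (λ K → ⟦ balanced? ω S K ⟧ * N ω S K)
      ≡⟨ cong (- 1# *_) (begin
        ∑ (subsets n) (λ K → ⟦ balanced? ω S K ⟧ * N ω S K)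
          ≡⟨ ∑-cong (subsets n) balanced-by-edges ⟩
        ∑ (subsets n) (λ K → ∑ (allFin n) (λ p → ∑ (allFin n) (λ q → entry p q K)))
          ≡⟨ ∑-swap (subsets n) (allFin n) (λ K p → ∑ (allFin n) (λ q → entry p q K)) ⟩
        ∑ (allFin n) (λ p → ∑ (subsets n) (λ K → ∑ (allFin n) (λ q → entry p q K)))
          ≡⟨ ∑-zero (allFin n) (λ p → trans
               (∑-swap (subsets n) (allFin n) (λ K q → entry p q K))
               (∑-zero (allFin n) (chosen-sum p))) ⟩
        0# ∎) ⟩
    - 1# * 0#
      ≡⟨⟩
    0# ∎
    where
    open ≡-Reasoning
    negate : ∀ b x → b * (- x) ≡ - 1# * (b * x)
    negate = from-yes (all? λ b → all? λ x → b * (- x) ≟ - 1# * (b * x))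

theorem4p3 : ∀ (r a n : ℕ) → a ≡ 4 ℕ.+ r → n ≡ 2 ℕ.* a ℕ.+ 3 →
    (ω : F₃^ (4 ℕ.+ r) → F₃^ (4 ℕ.+ r) → F₃) →
    IsAlternatingForm ω →
    (∀ x → InRadical ω x ⇔ InR x) →
    (∀ p q → ω (ιP p) (ιP q) ≡ ωP p q) →
    (S : Vector (F₃^ (4 ℕ.+ r)) n) →
    NoFull ω S →
    (∀ (i : Fin n) → projP (S i) ≢ 0ᵛ) →
    Θ ω S ≡ 0#
theorem4p3 r a n refl long ω isAlternating radical restriction S noFull nonzero =
  Blocks.Θ-vanishes long ω isAlternating radical restriction S noFull nonzero
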